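{- For every $\varepsilon>0$ there is a constant $C_\varepsilon$ such that the following holds. Let $N\geq 1$ be an integer, and suppose that for each odd prime $p\leq\sqrt{N}$ one is given an interval $I_p\subseteq\mathbb{Z}/p\mathbb{Z}$ of length $(p-1)/2$. Let $A\subseteq\{1,\dots,N\}$ be the set obtained by removing from $\{1,\dots,N\}$ every $n$ for which $n \bmod p$ lies in $I_p$ for some odd prime $p\leq\sqrt{N}$. Then $|A|\leq C_\varepsilon N^{1/3+\varepsilon}$ (the constant being independent of the choice of the intervals $I_p$).
   Context: An interval of length $L$ in $\mathbb{Z}/p\mathbb{Z}$ is a set of the form $\{a, a+1,\dots,a+L-1\} \pmod p$ for some $a\in\mathbb{Z}/p\mathbb{Z}$. The paper states the conclusion as $|A|\ll N^{1/3+o(1)}$. -}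

module Defs where

open import Data.Bool using (Bool; true; false; _∧_; not)
open import Data.Nat using (ℕ; zero; suc; _+_; _*_; _∸_; _/_; _%_; _≡ᵇ_; _≤ᵇ_)
open import Data.Nat.Primality using (prime?)
open import Data.List using (List; map; upTo; filterᵇ; length)
open import Data.Bool.ListAction using (any)
open import Relation.Nullary.Decidable using (isYes)

-- n mod p (only ever used with p an odd prime; the p = 0 case is a dummy)
modℕ : ℕ → ℕ → ℕ
modℕ zero    n = n
modℕ (suc q) n = n % suc q

oddPrimeᵇ : ℕ → Bool
oddPrimeᵇ p = isYes (prime? p) ∧ not (p ≡ᵇ 2)

-- (n mod p) ∈ I, where I = {s, s+1, ..., s+L-1} mod p with L = (p-1)/2
inIntervalᵇ : (p s n : ℕ) → Bool
inIntervalᵇ p s n =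
  any (λ k → modℕ p (s + k) ≡ᵇ modℕ p n) (upTo ((p ∸ 1) / 2))

survivesᵇ : (N : ℕ) → (s : ℕ → ℕ) → ℕ → Bool
survivesᵇ N s n =
  not (any (λ p → oddPrimeᵇ p ∧ ((p * p ≤ᵇ N) ∧ inIntervalᵇ p (s p) n))
           (upTo (suc N)))

-- the sieved set A ⊆ {1, ..., N}, as a (duplicate-free, increasing) list
sievedSet : (N : ℕ) → (s : ℕ → ℕ) → List ℕ
sievedSet N s = filterᵇ (survivesᵇ N s) (map suc (upTo N))

sievedCount : (N : ℕ) → (s : ℕ → ℕ) → ℕ
sievedCount N s = length (sievedSet N s)

module Submission where

-- The squares of deviations of arc counts modulo m are nonnegative for every m, so a lower bound
-- for the primes in a window [M, M + H) can be played against an average over all m there.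
-- For a prime p, half of the circle ℤ/p is empty, so many arcs of length w ≈ p/4 contain no
-- element of B and the count of elements in arcs has a large variance. Summed over all m in the
-- window and expanded, the variance is controlled by the pairs (a , a') through the number of
-- m ∣ a - a' + v with |v| < w. When |a - a'| is much larger than P and much smaller than P²
-- (P ≥ M being comparable to the largest usable prime), passing to the complementary divisor
-- shows that this number has its expected value up to a small relative error. Hence a positive
-- proportion (up to factors N^o(1)) of the pairs is at distance about P: a sieved set in an
-- interval of length P² concentrates in one of length about P. Two rounds, P ≈ N^(1/2) and then
-- P ≈ N^(1/4), leave a trivial bound N^(1/4 + o(1)), with enough room to spare that the
-- N^o(1) can be taken to be small powers of z = 2^l, N ≈ z^300. That primes are dense enough
-- is Chebyshev's bound, obtained from lcm(1, …, n) and beta integrals.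

open import Defs
open import Data.Bool using (true; false; if_then_else_; T; _∧_; not)
open import Data.Bool.Properties using (T-∧)
open import Data.List using (List; []; _∷_; map; upTo; length; filter)
open import Data.List.Membership.Propositional using (_∈_; lose)
open import Data.List.Membership.Propositional.Properties
  using (∈-upTo⁻; ∈-upTo⁺; ∈-filter⁺; ∈-filter⁻; ∈-map⁺; ∈-map⁻)
open import Data.List.Properties using (map-upTo; length-upTo)
open import Data.List.Relation.Unary.All as All using (_∷_)
open import Data.List.Relation.Unary.All.Properties as All using (all-filter)
open import Data.List.Relation.Unary.Any using (here; there)
open import Data.List.Relation.Unary.Any.Properties using (any⁺)
open import Data.Nat
open import Data.Nat.Coprimality using (Coprime; coprime-divisor)
open import Data.Nat.DivMod
open import Data.Nat.Divisibility
open import Data.Nat.Induction using (<-rec)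
open import Data.Nat.ListAction using (product)
open import Data.Nat.ListAction.Properties using (∈⇒∣product; product≢0)
open import Data.Nat.Primality using (Prime; prime?; prime⇒nonZero; prime⇒nonTrivial; prime⇒irreducible)
open import Data.Nat.Primality.Factorisation using (factorise)
open import Data.Nat.Properties
open import Data.Nat.Tactic.RingSolver using (solve-∀)
open import Data.Product using (∃-syntax; _×_; _,_; proj₁; proj₂)
open import Data.Sum using (_⊎_; inj₁; inj₂)
open import Function using (_∘_; it; Equivalence)
open import Relation.Binary.PropositionalEquality
  using (_≡_; _≢_; refl; sym; trans; cong; cong₂; subst; subst₂; module ≡-Reasoning)
open import Relation.Nullary using (¬_; Dec; yes; no; does; contradiction)
open import Relation.Nullary.Decidable using (_×-dec_; ¬?; T?; isYes; fromWitness)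
open import Relation.Unary using (Decidable)

private variable
  A B : Set
  P Q : Set

-- Finite sums over lists and initial segments of ℕ

∑ : List A → (A → ℕ) → ℕ
∑ []       f = 0
∑ (x ∷ xs) f = f x + ∑ xs f

∑< : ℕ → (ℕ → ℕ) → ℕ
∑< n = ∑ (upTo n)

infix 3 ∑ ∑<
syntax ∑ xs (λ x → e) = ∑[ x ∈ xs ] e
syntax ∑< n (λ i → e) = ∑[ i < n ] e

∑-mono : ∀ (xs : List A) {f g : A → ℕ} → (∀ {x} → x ∈ xs → f x ≤ g x) → ∑ xs f ≤ ∑ xs g
∑-mono []       h = z≤n
∑-mono (x ∷ xs) h = +-mono-≤ (h (here refl)) (∑-mono xs (h ∘ there))

∑-cong : ∀ (xs : List A) {f g : A → ℕ} → (∀ x → f x ≡ g x) → ∑ xs f ≡ ∑ xs g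
∑-cong []       h = refl
∑-cong (x ∷ xs) h = cong₂ _+_ (h x) (∑-cong xs h)

∑-const : ∀ (xs : List A) c → (∑[ _ ∈ xs ] c) ≡ length xs * c
∑-const []       c = refl
∑-const (x ∷ xs) c = cong (c +_) (∑-const xs c)

∑-distrib-+ : ∀ (xs : List A) (f g : A → ℕ) → (∑[ x ∈ xs ] (f x + g x)) ≡ ∑ xs f + ∑ xs g
∑-distrib-+ []       f g = refl
∑-distrib-+ (x ∷ xs) f g rewrite ∑-distrib-+ xs f g = +-interchange (f x) (g x) (∑ xs f) (∑ xs g)
  where
  +-interchange : ∀ a b c d → a + b + (c + d) ≡ a + c + (b + d)
  +-interchange = solve-∀

*-distribˡ-∑ : ∀ c (xs : List A) f → c * ∑ xs f ≡ (∑[ x ∈ xs ] c * f x)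
*-distribˡ-∑ c []       f = *-zeroʳ c
*-distribˡ-∑ c (x ∷ xs) f = trans (*-distribˡ-+ c (f x) (∑ xs f)) (cong (c * f x +_) (*-distribˡ-∑ c xs f))

*-distribʳ-∑ : ∀ c (xs : List A) f → ∑ xs f * c ≡ (∑[ x ∈ xs ] f x * c)
*-distribʳ-∑ c xs f = trans (*-comm (∑ xs f) c) (trans (*-distribˡ-∑ c xs f) (∑-cong xs λ x → *-comm c (f x)))

∑-*-∑ : ∀ (xs : List A) (ys : List B) f g → ∑ xs f * ∑ ys g ≡ (∑[ x ∈ xs ] ∑[ y ∈ ys ] f x * g y)
∑-*-∑ xs ys f g = trans (*-distribʳ-∑ (∑ ys g) xs f) (∑-cong xs λ x → *-distribˡ-∑ (f x) ys g)

∑-swap : ∀ (xs : List A) (ys : List B) (f : A → B → ℕ) →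
  (∑[ x ∈ xs ] ∑[ y ∈ ys ] f x y) ≡ (∑[ y ∈ ys ] ∑[ x ∈ xs ] f x y)
∑-swap []       ys f = sym (trans (∑-const ys 0) (*-zeroʳ (length ys)))
∑-swap (x ∷ xs) ys f = trans (cong (∑ ys (f x) +_) (∑-swap xs ys f))
                             (sym (∑-distrib-+ ys (f x) (λ y → ∑ xs (λ x → f x y))))

-- When no term reaches `c`, each falls short by at least 1. The summand `length xs` collects these
-- units, so that the pigeonhole principle below gets a strict inequality for nonempty lists.
∑-large-term : ∀ (xs : List A) f c → (∃[ x ] (x ∈ xs × c ≤ f x)) ⊎ (∑ xs f + length xs ≤ length xs * c)
∑-large-term []       f c = inj₂ z≤n
∑-large-term (x ∷ xs) f c with c ≤? f x | ∑-large-term xs f c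
... | yes c≤fx | _                       = inj₁ (x , here refl , c≤fx)
... | no  _    | inj₁ (y , y∈ , c≤fy)    = inj₁ (y , there y∈ , c≤fy)
... | no  c≰fx | inj₂ le                 = inj₂ (begin
  f x + ∑ xs f + suc (length xs)    ≡⟨ rearrange (f x) (∑ xs f) (length xs) ⟩
  suc (f x) + (∑ xs f + length xs)  ≤⟨ +-mono-≤ (≰⇒> c≰fx) le ⟩
  c + length xs * c                 ∎)
  where
  open ≤-Reasoning
  rearrange : ∀ a b n → a + b + suc n ≡ suc a + (b + n)
  rearrange = solve-∀

∑-pigeonhole : ∀ (xs : List A) f c → 0 < length xs → length xs * c ≤ ∑ xs f → ∃[ x ] (x ∈ xs × c ≤ f x)
∑-pigeonhole xs f c 0<n h with ∑-large-term xs f c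
... | inj₁ found = found
... | inj₂ le    = contradiction (≤-trans le h) (<⇒≱ (m<m+n (∑ xs f) 0<n))

∑<-mono : ∀ n {f g : ℕ → ℕ} → (∀ {i} → i < n → f i ≤ g i) → ∑< n f ≤ ∑< n g
∑<-mono n h = ∑-mono (upTo n) (h ∘ ∈-upTo⁻)

∑<-const : ∀ n c → (∑[ _ < n ] c) ≡ n * c
∑<-const n c = trans (∑-const (upTo n) c) (cong (_* c) (length-upTo n))

∑-map : ∀ (g : A → B) (xs : List A) f → ∑ (map g xs) f ≡ ∑ xs (f ∘ g)
∑-map g []       f = refl
∑-map g (x ∷ xs) f = cong (f (g x) +_) (∑-map g xs f)

∑<-suc : ∀ n f → ∑< (suc n) f ≡ f 0 + ∑< n (f ∘ suc)
∑<-suc n f = cong (f 0 +_) (trans (cong (λ xs → ∑ xs f) (sym (map-upTo suc n))) (∑-map suc (upTo n) f))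

∑<-+ : ∀ m n f → ∑< (m + n) f ≡ ∑< m f + ∑< n (f ∘ (m +_))
∑<-+ zero    n f = refl
∑<-+ (suc m) n f = begin
  ∑< (suc (m + n)) f                                ≡⟨ ∑<-suc (m + n) f ⟩
  f 0 + ∑< (m + n) (f ∘ suc)                        ≡⟨ cong (f 0 +_) (∑<-+ m n (f ∘ suc)) ⟩
  f 0 + (∑< m (f ∘ suc) + ∑< n (f ∘ (suc m +_)))    ≡⟨ +-assoc (f 0) _ _ ⟨
  f 0 + ∑< m (f ∘ suc) + ∑< n (f ∘ (suc m +_))      ≡⟨ cong (_+ ∑< n (f ∘ (suc m +_))) (∑<-suc m f) ⟨
  ∑< (suc m) f + ∑< n (f ∘ (suc m +_))              ∎
  where open ≡-Reasoning

∑<-≤ : ∀ {m n} f → m ≤ n → ∑< m f ≤ ∑< n f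
∑<-≤ {m} {n} f m≤n = begin
  ∑< m f                            ≤⟨ m≤m+n _ _ ⟩
  ∑< m f + ∑< (n ∸ m) (f ∘ (m +_))  ≡⟨ ∑<-+ m (n ∸ m) f ⟨
  ∑< (m + (n ∸ m)) f                ≡⟨ cong (λ k → ∑< k f) (m+[n∸m]≡n m≤n) ⟩
  ∑< n f                            ∎
  where open ≤-Reasoning

∑<-* : ∀ m n f → ∑< (m * n) f ≡ (∑[ j < m ] ∑[ i < n ] f (j * n + i))
∑<-* zero    n f = refl
∑<-* (suc m) n f = begin
  ∑< (n + m * n) f                                             ≡⟨ ∑<-+ n (m * n) f ⟩
  ∑< n f + ∑< (m * n) (f ∘ (n +_))                             ≡⟨ cong (∑< n f +_) (∑<-* m n (f ∘ (n +_))) ⟩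
  ∑< n f + (∑[ j < m ] ∑[ i < n ] f (n + (j * n + i)))         ≡⟨ cong (∑< n f +_) (∑-cong (upTo m) λ j → ∑-cong (upTo n) λ i → cong f (sym (+-assoc n (j * n) i))) ⟩
  ∑< n f + (∑[ j < m ] ∑[ i < n ] f (suc j * n + i))           ≡⟨ ∑<-suc m _ ⟨
  (∑[ j < suc m ] ∑[ i < n ] f (j * n + i))                    ∎
  where open ≡-Reasoning

-- Indicators of decidable propositions

𝟙 : Dec P → ℕ
𝟙 d = if does d then 1 else 0

𝟙-yes : (d : Dec P) → P → 𝟙 d ≡ 1
𝟙-yes (yes _) _ = refl
𝟙-yes (no ¬p) p = contradiction p ¬p

𝟙-no : (d : Dec P) → ¬ P → 𝟙 d ≡ 0
𝟙-no (yes p) ¬p = contradiction p ¬p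
𝟙-no (no _)  _  = refl

𝟙≤1 : (d : Dec P) → 𝟙 d ≤ 1
𝟙≤1 (yes _) = ≤-refl
𝟙≤1 (no _)  = z≤n

𝟙-≤ : (d : Dec P) {n : ℕ} → (P → 1 ≤ n) → 𝟙 d ≤ n
𝟙-≤ (yes p) h = h p
𝟙-≤ (no _)  h = z≤n

𝟙-mono : (d : Dec P) (e : Dec Q) → (P → Q) → 𝟙 d ≤ 𝟙 e
𝟙-mono d e h = 𝟙-≤ d λ p → ≤-reflexive (sym (𝟙-yes e (h p)))

𝟙-cong : (d : Dec P) (e : Dec Q) → (P → Q) → (Q → P) → 𝟙 d ≡ 𝟙 e
𝟙-cong d e f g = ≤-antisym (𝟙-mono d e f) (𝟙-mono e d g)

𝟙-*-≤ : (d : Dec P) {x y : ℕ} → (P → x ≤ y) → 𝟙 d * x ≤ y * 𝟙 d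
𝟙-*-≤ (yes p) {x} {y} h = subst₂ _≤_ (sym (+-identityʳ x)) (sym (*-identityʳ y)) (h p)
𝟙-*-≤ (no _)          h = z≤n

term≤∑ : ∀ {xs : List A} f {x} → x ∈ xs → f x ≤ ∑ xs f
term≤∑ f (here refl) = m≤m+n _ _
term≤∑ f (there x∈) = ≤-trans (term≤∑ f x∈) (m≤n+m _ _)

∑≡0 : ∀ (xs : List A) {f : A → ℕ} → (∀ {x} → x ∈ xs → f x ≡ 0) → ∑ xs f ≡ 0
∑≡0 []       h = refl
∑≡0 (x ∷ xs) h = cong₂ _+_ (h (here refl)) (∑≡0 xs (h ∘ there))

∑<-unique : ∀ n {P : ℕ → Set} (P? : ∀ i → Dec (P i)) →
  (∀ {i j} → P i → P j → i ≡ j) → (∑[ i < n ] 𝟙 (P? i)) ≤ 1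
∑<-unique zero    P? u = z≤n
∑<-unique (suc n) {P} P? u = subst (_≤ 1) (sym (∑<-suc n (λ i → 𝟙 (P? i)))) (split (P? 0))
  where
  split : (d : Dec (P 0)) → 𝟙 d + (∑[ i < n ] 𝟙 (P? (suc i))) ≤ 1
  split (no _)   = ∑<-unique n (P? ∘ suc) (λ p q → suc-injective (u p q))
  split (yes p₀) = s≤s (≤-reflexive (∑≡0 (upTo n) λ {i} _ → 𝟙-no (P? (suc i)) λ p → contradiction (u p p₀) λ ()))

length-filter-∑ : ∀ {P : A → Set} (P? : Decidable P) (xs : List A) → length (filter P? xs) ≡ (∑[ x ∈ xs ] 𝟙 (P? x))
length-filter-∑ P? []       = refl
length-filter-∑ P? (x ∷ xs) with does (P? x)
... | true  = cong suc (length-filter-∑ P? xs)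
... | false = length-filter-∑ P? xs

∑-filter-≤ : ∀ {P : A → Set} (P? : Decidable P) (xs : List A) f → ∑ (filter P? xs) f ≤ ∑ xs f
∑-filter-≤ P? []       f = z≤n
∑-filter-≤ P? (x ∷ xs) f with does (P? x)
... | true  = +-monoʳ-≤ (f x) (∑-filter-≤ P? xs f)
... | false = ≤-trans (∑-filter-≤ P? xs f) (m≤n+m _ _)

-- Cut [0, v + m) once at v and once at m: the two pieces of length v have equal sums by periodicity
-- and cancel.
∑<-periodic : ∀ m g → (∀ t → g (m + t) ≡ g t) → ∀ v → (∑[ t < m ] g (v + t)) ≡ ∑< m g
∑<-periodic m g per v = +-cancelˡ-≡ (∑< v g) _ _ (begin
  ∑< v g + (∑[ t < m ] g (v + t))  ≡⟨ ∑<-+ v m g ⟨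
  ∑< (v + m) g                     ≡⟨ cong (λ k → ∑< k g) (+-comm v m) ⟩
  ∑< (m + v) g                     ≡⟨ ∑<-+ m v g ⟩
  ∑< m g + (∑[ t < v ] g (m + t))  ≡⟨ cong (∑< m g +_) (∑-cong (upTo v) per) ⟩
  ∑< m g + ∑< v g                  ≡⟨ +-comm (∑< m g) (∑< v g) ⟩
  ∑< v g + ∑< m g                  ∎)
  where open ≡-Reasoning

-- Congruences and arc counts

-- `modℕ` is the reduction that `inIntervalᵇ` compares, so the sieve of the statement translates
-- directly. Modulus 0 gives equality.
_≈[_]_ : ℕ → ℕ → ℕ → Set
u ≈[ m ] v = modℕ m u ≡ modℕ m v

_≈?[_]_ : ∀ u m v → Dec (u ≈[ m ] v)
u ≈?[ m ] v = modℕ m u ≟ modℕ m v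

≈-+ʳ : ∀ m {u v} c → u ≈[ m ] v → (u + c) ≈[ m ] (v + c)
≈-+ʳ zero    c eq = cong (_+ c) eq
≈-+ʳ (suc m) {u} {v} c eq = begin
  (u + c) % suc m                  ≡⟨ %-distribˡ-+ u c (suc m) ⟩
  (u % suc m + c % suc m) % suc m  ≡⟨ cong (λ r → (r + c % suc m) % suc m) eq ⟩
  (v % suc m + c % suc m) % suc m  ≡⟨ %-distribˡ-+ v c (suc m) ⟨
  (v + c) % suc m                  ∎
  where open ≡-Reasoning

≈-shift : ∀ m .{{_ : NonZero m}} u → (m + u) ≈[ m ] u
≈-shift m@(suc _) u = trans (cong (_% m) (+-comm m u)) ([m+n]%n≡m%n u m)

modℕ-< : ∀ m .{{_ : NonZero m}} u → modℕ m u < m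
modℕ-< (suc m) u = m%n<n u (suc m)

modℕ-small : ∀ m {u} → u < m → modℕ m u ≡ u
modℕ-small (suc m) u<m = m<n⇒m%n≡m u<m

∣⇒≈0 : ∀ m u → m ∣ u → u ≈[ m ] 0
∣⇒≈0 zero    u m∣u = 0∣⇒≡0 m∣u
∣⇒≈0 (suc m) u m∣u = n∣m⇒m%n≡0 u (suc m) m∣u

≈⇒∣ : ∀ m u v → (u + v) ≈[ m ] v → m ∣ u
≈⇒∣ zero    u v eq = subst (0 ∣_) (sym (+-cancelʳ-≡ v u 0 eq)) ∣-refl
≈⇒∣ m@(suc _) u v eq = ∣m+n∣m⇒∣n (subst (m ∣_) (cancel u v eq) (n∣m*n ((u + v) / m))) (n∣m*n (v / m))
  where
  open ≡-Reasoning
  cancel : ∀ u v → (u + v) % m ≡ v % m → (u + v) / m * m ≡ v / m * m + u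
  cancel u v eq = +-cancelˡ-≡ (v % m) _ _ (begin
    v % m + (u + v) / m * m        ≡⟨ cong (_+ (u + v) / m * m) eq ⟨
    (u + v) % m + (u + v) / m * m  ≡⟨ m≡m%n+[m/n]*n (u + v) m ⟨
    u + v                          ≡⟨ +-comm u v ⟩
    v + u                          ≡⟨ cong (_+ u) (m≡m%n+[m/n]*n v m) ⟩
    v % m + v / m * m + u          ≡⟨ +-assoc (v % m) _ u ⟩
    v % m + (v / m * m + u)        ∎)

hit : ℕ → ℕ → ℕ → ℕ
hit m u a = 𝟙 (u ≈?[ m ] a)

hit-shift : ∀ m .{{_ : NonZero m}} u a → hit m (m + u) a ≡ hit m u a
hit-shift m u a = 𝟙-cong ((m + u) ≈?[ m ] a) (u ≈?[ m ] a) (trans (sym (≈-shift m u))) (trans (≈-shift m u))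

∑-hit-residues : ∀ m .{{_ : NonZero m}} a → (∑[ t < m ] hit m t a) ≡ 1
∑-hit-residues m a = ≤-antisym
  (≤-trans (∑<-mono m λ {i} i<m → 𝟙-mono (i ≈?[ m ] a) (i ≟ modℕ m a) (trans (sym (modℕ-small m i<m))))
           (∑<-unique m (_≟ modℕ m a) λ p q → trans p (sym q)))
  (≤-trans (≤-reflexive (sym (𝟙-yes (modℕ m a ≈?[ m ] a) (modℕ-small m (modℕ-< m a)))))
           (term≤∑ (λ t → hit m t a) (∈-upTo⁺ (modℕ-< m a))))

∑-hit-shifted : ∀ m .{{_ : NonZero m}} u a → (∑[ t < m ] hit m (u + t) a) ≡ 1
∑-hit-shifted m u a = trans (∑<-periodic m (λ t → hit m t a) (λ t → hit-shift m t a) u) (∑-hit-residues m a)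

-- The range may be enlarged to `k` full periods, each of which meets the class of `a` exactly once.
∑-hit-≤ : ∀ m .{{_ : NonZero m}} {w} k u a → w ≤ k * m → (∑[ v < w ] hit m (u + v) a) ≤ k
∑-hit-≤ m {w} k u a w≤km = begin
  (∑[ v < w ] hit m (u + v) a)                       ≤⟨ ∑<-≤ (λ v → hit m (u + v) a) w≤km ⟩
  (∑[ v < k * m ] hit m (u + v) a)                   ≡⟨ ∑<-* k m (λ v → hit m (u + v) a) ⟩
  (∑[ j < k ] ∑[ i < m ] hit m (u + (j * m + i)) a)  ≡⟨ ∑-cong (upTo k) one-period ⟩
  (∑[ _ < k ] 1)                                     ≡⟨ ∑<-const k 1 ⟩
  k * 1                                              ≡⟨ *-identityʳ k ⟩
  k                                                  ∎
  where
  open ≤-Reasoning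
  one-period : ∀ j → (∑[ i < m ] hit m (u + (j * m + i)) a) ≡ 1
  one-period j = trans (∑-cong (upTo m) λ i → cong (λ x → hit m x a) (sym (+-assoc u (j * m) i)))
                       (∑-hit-shifted m (u + j * m) a)

-- The variance of arc counts modulo a single m

2xy≤x²+y² : ∀ x y → 2 * (x * y) ≤ x * x + y * y
2xy≤x²+y² x y with ≤-total x y
... | inj₁ x≤y with k , refl ← m≤n⇒∃[o]m+o≡n x≤y = ≤-trans (m≤m+n _ (k * k)) (≤-reflexive (square x k))
  where square : ∀ x k → 2 * (x * (x + k)) + k * k ≡ x * x + (x + k) * (x + k)
        square = solve-∀
... | inj₂ y≤x with k , refl ← m≤n⇒∃[o]m+o≡n y≤x = ≤-trans (m≤m+n _ (k * k)) (≤-reflexive (square y k))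
  where square : ∀ y k → 2 * ((y + k) * y) + k * k ≡ (y + k) * (y + k) + y * y
        square = solve-∀

OddPrime : ℕ → Set
OddPrime p = Prime p × p ≢ 2

oddPrime? : ∀ p → Dec (OddPrime p)
oddPrime? p = prime? p ×-dec ¬? (p ≟ 2)

Misses : List ℕ → ℕ → ℕ → ℕ → Set
Misses B p s L = ∀ {a k} → a ∈ B → k < L → ¬ ((s + k) ≈[ p ] a)

module Variance (B : List ℕ) (w : ℕ) where

  n = length B

  arc : ℕ → ℕ → ℕ → ℕ
  arc m t a = ∑[ v < w ] hit m (t + v) a

  cnt : ℕ → ℕ → ℕ
  cnt m t = ∑[ a ∈ B ] arc m t a

  -- Eliminating the start t of an arc from t + v ≡ a and t + v' ≡ a' leaves a + v' ≡ a' + v, a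
  -- condition free of subtraction. Summed over v and v', it measures how many arcs contain both a
  -- and a'.
  corr : ℕ → ℕ → ℕ → ℕ
  corr m a a' = ∑[ v < w ] ∑[ v' < w ] hit m (a + v') (a' + v)

  ∑-cnt : ∀ m .{{_ : NonZero m}} → (∑[ t < m ] cnt m t) ≡ w * n
  ∑-cnt m = begin
    (∑[ t < m ] cnt m t)            ≡⟨ ∑-swap (upTo m) B (arc m) ⟩
    (∑[ a ∈ B ] ∑[ t < m ] arc m t a)  ≡⟨ ∑-cong B arcs ⟩
    (∑[ a ∈ B ] w)                  ≡⟨ ∑-const B w ⟩
    n * w                           ≡⟨ *-comm n w ⟩
    w * n                           ∎
    where
    open ≡-Reasoning
    arcs : ∀ a → (∑[ t < m ] arc m t a) ≡ w
    arcs a = begin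
      (∑[ t < m ] ∑[ v < w ] hit m (t + v) a)  ≡⟨ ∑-swap (upTo m) (upTo w) _ ⟩
      (∑[ v < w ] ∑[ t < m ] hit m (t + v) a)  ≡⟨ ∑-cong (upTo w) (λ v → trans (∑-cong (upTo m) λ t → cong (λ x → hit m x a) (+-comm t v)) (∑-hit-shifted m v a)) ⟩
      (∑[ v < w ] 1)                           ≡⟨ ∑<-const w 1 ⟩
      w * 1                                    ≡⟨ *-identityʳ w ⟩
      w                                        ∎

  -- The two congruences on t together force a + v' ≡ a' + v, and the first one alone has exactly
  -- one solution t in a period.
  hit*hit≤ : ∀ m .{{_ : NonZero m}} a a' v v' →
    (∑[ t < m ] hit m (t + v) a * hit m (t + v') a') ≤ hit m (a + v') (a' + v)
  hit*hit≤ m a a' v v' = begin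
    (∑[ t < m ] hit m (t + v) a * hit m (t + v') a')                ≤⟨ ∑<-mono m (λ {t} _ → pointwise t) ⟩
    (∑[ t < m ] hit m (a + v') (a' + v) * hit m (v + t) a)          ≡⟨ *-distribˡ-∑ (hit m (a + v') (a' + v)) (upTo m) _ ⟨
    hit m (a + v') (a' + v) * (∑[ t < m ] hit m (v + t) a)          ≡⟨ cong (hit m (a + v') (a' + v) *_) (∑-hit-shifted m v a) ⟩
    hit m (a + v') (a' + v) * 1                                     ≡⟨ *-identityʳ _ ⟩
    hit m (a + v') (a' + v)                                         ∎
    where
    open ≤-Reasoning
    pointwise : ∀ t → hit m (t + v) a * hit m (t + v') a' ≤ hit m (a + v') (a' + v) * hit m (v + t) a
    pointwise t rewrite +-comm v t = 𝟙-*-≤ ((t + v) ≈?[ m ] a) λ p →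
      𝟙-mono ((t + v') ≈?[ m ] a') ((a + v') ≈?[ m ] (a' + v)) λ q →
        trans (sym (≈-+ʳ m v' p)) (trans (cong (modℕ m) (swap t v v')) (≈-+ʳ m v q))
      where
      swap : ∀ t v v' → t + v + v' ≡ t + v' + v
      swap = solve-∀

  ∑-cnt² : ∀ m .{{_ : NonZero m}} → (∑[ t < m ] cnt m t * cnt m t) ≤ (∑[ a ∈ B ] ∑[ a' ∈ B ] corr m a a')
  ∑-cnt² m = begin
    (∑[ t < m ] cnt m t * cnt m t)
      ≡⟨ ∑-cong (upTo m) (λ t → ∑-*-∑ B B (arc m t) (arc m t)) ⟩
    (∑[ t < m ] ∑[ a ∈ B ] ∑[ a' ∈ B ] arc m t a * arc m t a')
      ≡⟨ ∑-swap (upTo m) B _ ⟩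
    (∑[ a ∈ B ] ∑[ t < m ] ∑[ a' ∈ B ] arc m t a * arc m t a')
      ≡⟨ ∑-cong B (λ a → ∑-swap (upTo m) B _) ⟩
    (∑[ a ∈ B ] ∑[ a' ∈ B ] ∑[ t < m ] arc m t a * arc m t a')
      ≤⟨ ∑-mono B (λ {a} _ → ∑-mono B (λ {a'} _ → pair a a')) ⟩
    (∑[ a ∈ B ] ∑[ a' ∈ B ] corr m a a') ∎
    where
    open ≤-Reasoning
    pair : ∀ a a' → (∑[ t < m ] arc m t a * arc m t a') ≤ corr m a a'
    pair a a' = begin
      (∑[ t < m ] arc m t a * arc m t a')
        ≡⟨ ∑-cong (upTo m) (λ t → ∑-*-∑ (upTo w) (upTo w) _ _) ⟩
      (∑[ t < m ] ∑[ v < w ] ∑[ v' < w ] hit m (t + v) a * hit m (t + v') a')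
        ≡⟨ ∑-swap (upTo m) (upTo w) _ ⟩
      (∑[ v < w ] ∑[ t < m ] ∑[ v' < w ] hit m (t + v) a * hit m (t + v') a')
        ≡⟨ ∑-cong (upTo w) (λ v → ∑-swap (upTo m) (upTo w) _) ⟩
      (∑[ v < w ] ∑[ v' < w ] ∑[ t < m ] hit m (t + v) a * hit m (t + v') a')
        ≤⟨ ∑<-mono w (λ {v} _ → ∑<-mono w (λ {v'} _ → hit*hit≤ m a a' v v')) ⟩
      corr m a a' ∎

  empties : ℕ → ℕ
  empties m = ∑[ t < m ] 𝟙 (cnt m t ≟ 0)

  -- If the residue window [s, s + 2w - 1) is missed, the w shorter windows inside it are empty.
  w≤empties : ∀ p .{{_ : NonZero p}} s L → w ≤ p → w + w ≤ suc L → Misses B p s L → w ≤ empties p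
  w≤empties p s L w≤p 2w≤1+L miss = begin
    w                                        ≡⟨ *-identityʳ w ⟨
    w * 1                                    ≡⟨ ∑<-const w 1 ⟨
    (∑[ t < w ] 1)                           ≤⟨ ∑<-mono w (λ {t} t<w → ≤-reflexive (sym (𝟙-yes (cnt p (s + t) ≟ 0) (empty t<w)))) ⟩
    (∑[ t < w ] 𝟙 (cnt p (s + t) ≟ 0))       ≤⟨ ∑<-≤ (λ t → 𝟙 (cnt p (s + t) ≟ 0)) w≤p ⟩
    (∑[ t < p ] 𝟙 (cnt p (s + t) ≟ 0))       ≡⟨ ∑<-periodic p (λ t → 𝟙 (cnt p t ≟ 0)) (λ t → cong (λ c → 𝟙 (c ≟ 0)) (cnt-shift t)) s ⟩
    empties p                                ∎
    where
    open ≤-Reasoning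
    cnt-shift : ∀ t → cnt p (p + t) ≡ cnt p t
    cnt-shift t = ∑-cong B λ a → ∑-cong (upTo w) λ v →
      trans (cong (λ x → hit p x a) (+-assoc p t v)) (hit-shift p (t + v) a)
    empty : ∀ {t} → t < w → cnt p (s + t) ≡ 0
    empty {t} t<w = ∑≡0 B λ {a} a∈ → ∑≡0 (upTo w) λ {v} v∈ →
      𝟙-no ((s + t + v) ≈?[ p ] a) λ eq → miss a∈ (s<s⁻¹ (begin
        2 + (t + v)          ≡⟨ cong suc (+-suc t v) ⟨
        suc t + suc v        ≤⟨ +-mono-≤ t<w (∈-upTo⁻ v∈) ⟩
        w + w                ≤⟨ 2w≤1+L ⟩
        suc L                ∎)) (trans (cong (modℕ p) (sym (+-assoc s t v))) eq)

  -- This is (X c - y)² ≥ 0 with a bonus: at c = 0 the cross term vanishes, so the y² on the right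
  -- can pay for the indicator. Empty arcs thus contribute a definite gain.
  variance-pointwise : ∀ X c y → 2 * X * y * c + y * y * 𝟙 (c ≟ 0) ≤ X * X * (c * c) + y * y
  variance-pointwise X zero    y = ≤-reflexive (at-zero X y)
    where at-zero : ∀ X y → 2 * X * y * 0 + y * y * 1 ≡ X * X * 0 + y * y
          at-zero = solve-∀
  variance-pointwise X c@(suc _) y = begin
    2 * X * y * c + y * y * 0     ≡⟨ lhs X c y ⟩
    2 * (X * c * y)               ≤⟨ 2xy≤x²+y² (X * c) y ⟩
    X * c * (X * c) + y * y       ≡⟨ cong (_+ y * y) (rhs X c) ⟩
    X * X * (c * c) + y * y       ∎
    where
    open ≤-Reasoning
    lhs : ∀ X c y → 2 * X * y * c + y * y * 0 ≡ 2 * (X * c * y)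
    lhs = solve-∀
    rhs : ∀ X c → X * c * (X * c) ≡ X * X * (c * c)
    rhs = solve-∀

  -- Sum the pointwise inequality over a period, where the first moment is exactly w n. The weight
  -- `X` is not tied to `m`, so that one value can serve every modulus of a window.
  variance : ∀ m .{{_ : NonZero m}} X y →
    2 * X * y * (w * n) + y * y * empties m ≤ X * X * (∑[ a ∈ B ] ∑[ a' ∈ B ] corr m a a') + m * (y * y)
  variance m X y = begin
    2 * X * y * (w * n) + y * y * empties m
      ≡⟨ cong₂ _+_ (trans (cong (2 * X * y *_) (sym (∑-cnt m))) (*-distribˡ-∑ (2 * X * y) (upTo m) (cnt m)))
                   (*-distribˡ-∑ (y * y) (upTo m) _) ⟩
    (∑[ t < m ] 2 * X * y * cnt m t) + (∑[ t < m ] y * y * 𝟙 (cnt m t ≟ 0))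
      ≡⟨ ∑-distrib-+ (upTo m) _ _ ⟨
    (∑[ t < m ] (2 * X * y * cnt m t + y * y * 𝟙 (cnt m t ≟ 0)))
      ≤⟨ ∑<-mono m (λ {t} _ → variance-pointwise X (cnt m t) y) ⟩
    (∑[ t < m ] (X * X * (cnt m t * cnt m t) + y * y))
      ≡⟨ ∑-distrib-+ (upTo m) _ _ ⟩
    (∑[ t < m ] X * X * (cnt m t * cnt m t)) + (∑[ t < m ] y * y)
      ≡⟨ cong₂ _+_ (sym (*-distribˡ-∑ (X * X) (upTo m) _)) (∑<-const m (y * y)) ⟩
    X * X * (∑[ t < m ] cnt m t * cnt m t) + m * (y * y)
      ≤⟨ +-monoˡ-≤ (m * (y * y)) (*-monoʳ-≤ (X * X) (∑-cnt² m)) ⟩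
    X * X * (∑[ a ∈ B ] ∑[ a' ∈ B ] corr m a a') + m * (y * y) ∎
    where open ≤-Reasoning

  corr≤w : ∀ m .{{_ : NonZero m}} → w ≤ m → ∀ a a' → corr m a a' ≤ w
  corr≤w m w≤m a a' = begin
    corr m a a'     ≤⟨ ∑<-mono w (λ {v} _ → ∑-hit-≤ m 1 a (a' + v) (≤-trans w≤m (≤-reflexive (sym (+-identityʳ m))))) ⟩
    (∑[ _ < w ] 1)  ≡⟨ ∑<-const w 1 ⟩
    w * 1           ≡⟨ *-identityʳ w ⟩
    w               ∎
    where open ≤-Reasoning

  corr-sym : ∀ m a a' → corr m a a' ≡ corr m a' a
  corr-sym m a a' = trans (∑-swap (upTo w) (upTo w) _)
    (∑-cong (upTo w) λ v' → ∑-cong (upTo w) λ v → 𝟙-cong ((a + v') ≈?[ m ] (a' + v)) ((a' + v) ≈?[ m ] (a + v')) sym sym)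

-- Divisors in short intervals

divisorPairs : (M H w c : ℕ) → ℕ
divisorPairs M H w c = ∑[ i < H ] ∑[ v < w ] 𝟙 ((M + i) ∣? (c + v))

-- Counts the pairs (m , v) with m ∣ c + v by the complementary divisor q = (c + v) / m.
divisorPairs-switch : ∀ M H w c q₀ nq κ .{{_ : NonZero q₀}} → w ≤ κ * q₀ →
  (∀ {q i v} → i < H → v < w → c + v ≡ q * (M + i) → q₀ ≤ q × q < q₀ + nq) →
  divisorPairs M H w c ≤ nq * κ
divisorPairs-switch M H w c q₀ nq κ w≤κq₀ range = begin
  (∑[ i < H ] ∑[ v < w ] 𝟙 ((M + i) ∣? (c + v)))
    ≤⟨ ∑<-mono H (λ i<H → ∑<-mono w (λ v<w → 𝟙-≤ (_ ∣? _) (witness i<H v<w))) ⟩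
  (∑[ i < H ] ∑[ v < w ] ∑[ k < nq ] 𝟙 (factors? i v k))
    ≡⟨ ∑-cong (upTo H) (λ i → ∑-swap (upTo w) (upTo nq) _) ⟩
  (∑[ i < H ] ∑[ k < nq ] ∑[ v < w ] 𝟙 (factors? i v k))
    ≡⟨ ∑-swap (upTo H) (upTo nq) _ ⟩
  (∑[ k < nq ] ∑[ i < H ] ∑[ v < w ] 𝟙 (factors? i v k))
    ≡⟨ ∑-cong (upTo nq) (λ k → ∑-swap (upTo H) (upTo w) _) ⟩
  (∑[ k < nq ] ∑[ v < w ] ∑[ i < H ] 𝟙 (factors? i v k))
    ≤⟨ ∑<-mono nq (λ {k} _ → multiples k) ⟩
  (∑[ k < nq ] κ)
    ≡⟨ ∑<-const nq κ ⟩
  nq * κ ∎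
  where
  open ≤-Reasoning
  factors? : ∀ i v k → Dec (c + v ≡ (q₀ + k) * (M + i))
  factors? i v k = c + v ≟ (q₀ + k) * (M + i)

  witness : ∀ {i v} → i < H → v < w → M + i ∣ c + v → 1 ≤ (∑[ k < nq ] 𝟙 (factors? i v k))
  witness {i} {v} i<H v<w (divides q eq) with q₀≤q , q<q₀+nq ← range {q} i<H v<w eq with k , refl ← m≤n⇒∃[o]m+o≡n q₀≤q =
    ≤-trans (≤-reflexive (sym (𝟙-yes (factors? i v k) eq)))
            (term≤∑ (λ k → 𝟙 (factors? i v k)) (∈-upTo⁺ (+-cancelˡ-< q₀ k nq q<q₀+nq)))

  one-m : ∀ k v → (∑[ i < H ] 𝟙 (factors? i v k)) ≤ hit (q₀ + k) (c + v) 0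
  one-m k v with (q₀ + k) ∣? (c + v)
  ... | yes q∣ = ≤-trans (∑<-unique H (λ i → factors? i v k) λ {i} {j} p q → +-cancelˡ-≡ M i j (*-cancelˡ-≡ _ _ (q₀ + k) {{m+n≢0}} (trans (sym p) q)))
                         (≤-reflexive (sym (𝟙-yes ((c + v) ≈?[ q₀ + k ] 0) (∣⇒≈0 (q₀ + k) (c + v) q∣))))
    where
    m+n≢0 : NonZero (q₀ + k)
    m+n≢0 = >-nonZero (≤-trans (>-nonZero⁻¹ q₀) (m≤m+n q₀ k))
  ... | no ¬q∣ = ≤-trans (≤-reflexive (∑≡0 (upTo H) λ {i} _ → 𝟙-no (factors? i v k) λ eq → ¬q∣ (divides (M + i) (trans eq (*-comm (q₀ + k) (M + i)))))) z≤n

  -- A run of w ≤ κ q₀ ≤ κ q consecutive integers contains at most κ multiples of q = q₀ + k.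
  multiples : ∀ k → (∑[ v < w ] ∑[ i < H ] 𝟙 (factors? i v k)) ≤ κ
  multiples k = ≤-trans (∑<-mono w (λ {v} _ → one-m k v))
    (∑-hit-≤ (q₀ + k) {{>-nonZero (≤-trans (>-nonZero⁻¹ q₀) (m≤m+n q₀ k))}} κ c 0
      (≤-trans w≤κq₀ (*-monoʳ-≤ κ (m≤m+n q₀ k))))

-- The complementary divisor q lies above c / X and is at most (c + w) / M, which leaves at most (c
-- H + w X + M X) / (M X) values. Each value serves at most (w X + c + X) / c of the v. The
-- denominators are cleared.
divisorPairs-≤ : ∀ M H w c .{{_ : NonZero M}} .{{_ : NonZero c}} → let X = M + H in
  M * c * (X * divisorPairs M H w c) ≤ (c * H + w * X + M * X) * (w * X + c + X)
divisorPairs-≤ M H w c = begin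
  M * c * (X * divisorPairs M H w c)
    ≤⟨ *-monoʳ-≤ (M * c) (*-monoʳ-≤ X (divisorPairs-switch M H w c q₀ nq κ w≤κq₀ range)) ⟩
  M * c * (X * (nq * κ))
    ≡⟨ regroup M c X nq κ ⟩
  (nq * M * X) * (κ * c)
    ≤⟨ *-mono-≤ nq-bound κ-bound ⟩
  (c * H + w * X + M * X) * (w * X + c + X) ∎
  where
  open ≤-Reasoning
  X = M + H
  instance
    X≢0 : NonZero X
    X≢0 = >-nonZero (≤-trans (>-nonZero⁻¹ M) (m≤m+n M H))
  -- The successor is justified because m < X makes c < q X strict.
  q₀ = suc (c / X)
  q₁ = (c + w) / M
  nq = suc q₁ ∸ q₀
  κ  = suc (w / q₀)

  regroup : ∀ M c X nq κ → M * c * (X * (nq * κ)) ≡ (nq * M * X) * (κ * c)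
  regroup = solve-∀

  n<sn/d*d : ∀ n d .{{_ : NonZero d}} → n < suc (n / d) * d
  n<sn/d*d n d = begin-strict
    n                    ≡⟨ m≡m%n+[m/n]*n n d ⟩
    n % d + n / d * d    <⟨ +-monoˡ-< (n / d * d) (m%n<n n d) ⟩
    d + n / d * d        ∎

  w≤κq₀ : w ≤ κ * q₀
  w≤κq₀ = <⇒≤ (n<sn/d*d w q₀)

  range : ∀ {q i v} → i < H → v < w → c + v ≡ q * (M + i) → q₀ ≤ q × q < q₀ + nq
  range {zero} i<H v<w eq = contradiction (m+n≡0⇒m≡0 c eq) (≢-nonZero⁻¹ c)
  range {q@(suc _)} {i} {v} i<H v<w eq = q₀≤q , (begin-strict
    q                   <⟨ q≤q₁ ⟩
    suc q₁              ≤⟨ m≤n+m∸n (suc q₁) q₀ ⟩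
    q₀ + nq             ∎)
    where
    q₀≤q : q₀ ≤ q
    q₀≤q = m<n*o⇒m/o<n {c} {q} {X} (begin-strict
      c             ≤⟨ m≤m+n c v ⟩
      c + v         ≡⟨ eq ⟩
      q * (M + i)   <⟨ *-monoʳ-< q (+-monoʳ-< M i<H) ⟩
      q * X         ∎)
    q≤q₁ : q < suc q₁
    q≤q₁ = *-cancelʳ-< M q (suc q₁) (begin-strict
      q * M            ≤⟨ *-monoʳ-≤ q (m≤m+n M i) ⟩
      q * (M + i)      ≡⟨ eq ⟨
      c + v            ≤⟨ +-monoʳ-≤ c (<⇒≤ v<w) ⟩
      c + w            <⟨ n<sn/d*d (c + w) M ⟩
      suc q₁ * M       ∎)

  q₀X-lower : c ≤ q₀ * X
  q₀X-lower = <⇒≤ (n<sn/d*d c X)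

  nq-bound : nq * M * X ≤ c * H + w * X + M * X
  nq-bound with ≤-total (suc q₁) q₀
  -- Here no q is possible and the truncated difference `nq` is 0.
  ... | inj₁ le rewrite m≤n⇒m∸n≡0 le = z≤n
  ... | inj₂ ge = +-cancelˡ-≤ (M * c) _ _ (begin
    M * c + nq * M * X            ≤⟨ +-monoˡ-≤ (nq * M * X) (*-monoʳ-≤ M q₀X-lower) ⟩
    M * (q₀ * X) + nq * M * X     ≡⟨ collect M q₀ nq X ⟩
    (nq + q₀) * M * X             ≡⟨ cong (λ k → k * M * X) (m∸n+n≡m ge) ⟩
    suc q₁ * M * X                ≤⟨ *-monoˡ-≤ X (+-monoʳ-≤ M (m/n*n≤m (c + w) M)) ⟩
    (M + (c + w)) * X             ≡⟨ expand M c w H ⟩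
    M * c + (c * H + w * X + M * X) ∎)
    where
    collect : ∀ M q n X → M * (q * X) + n * M * X ≡ (n + q) * M * X
    collect = solve-∀
    expand : ∀ M c w H → (M + (c + w)) * (M + H) ≡ M * c + (c * H + w * (M + H) + M * (M + H))
    expand = solve-∀

  κ-bound : κ * c ≤ w * X + c + X
  κ-bound = begin
    κ * c                     ≤⟨ *-monoʳ-≤ κ q₀X-lower ⟩
    κ * (q₀ * X)              ≡⟨ *-assoc κ q₀ X ⟨
    (q₀ + w / q₀ * q₀) * X    ≤⟨ *-monoˡ-≤ X (+-monoʳ-≤ q₀ (m/n*n≤m w q₀)) ⟩
    (q₀ + w) * X              ≡⟨ *-distribʳ-+ X q₀ w ⟩
    X + c / X * X + w * X     ≤⟨ +-monoˡ-≤ (w * X) (+-monoʳ-≤ X (m/n*n≤m c X)) ⟩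
    X + c + w * X             ≡⟨ rotate X c (w * X) ⟩
    w * X + c + X             ∎
    where
    rotate : ∀ a b c → a + b + c ≡ c + b + a
    rotate = solve-∀

-- The number of pairs exceeds its expected value H w / X · w by a factor of at most 1 + 10 / R.
divisorPairs-equidistributed : ∀ H w c R .{{_ : NonZero w}} .{{_ : NonZero c}} .{{_ : NonZero R}} →
  H ≤ w → R * H ≤ 4 * w → 5 * R ≤ 4 * w → 16 * (w * w) * R ≤ c * H → c * R ≤ 4 * (w * w) →
  R * ((4 * w + H) * divisorPairs (4 * w) H w c) ≤ (R + 10) * (H * w)
divisorPairs-equidistributed H w c R H≤w RH≤4w 5R≤4w far near =
  *-cancelˡ-≤ (M * c) {{m*n≢0 M c}} (begin
    M * c * (R * (X * S))                      ≡⟨ x∙yz M c R (X * S) ⟩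
    R * (M * c * (X * S))                      ≤⟨ *-monoʳ-≤ R (divisorPairs-≤ M H w c) ⟩
    R * ((c * H + w * X + M * X) * F)          ≡⟨ expand R c H w ⟩
    -- The first summand is the main term. In units of c H w², the errors come to 4 + 4 + 4 from the
    -- middle summand and 2 · 14 from the last, together 40 = 4 · 10, whence the 10 in R + 10.
    R * (c * H) * (4 * (w * w)) + c * H * (w * (R * H) + c * R + R * X) + R * (5 * (w * X)) * F
      ≤⟨ +-mono-≤ (+-monoʳ-≤ _ (*-monoʳ-≤ (c * H) (+-mono-≤ (+-mono-≤ (*-monoʳ-≤ w RH≤4w) near) RX≤))) (*-mono-≤ R5wX≤ F≤) ⟩
    R * (c * H) * (4 * (w * w)) + c * H * (w * (4 * w) + 4 * (w * w) + 4 * (w * w)) + 2 * (c * H) * (14 * (w * w))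
      ≡⟨ collect R c H w ⟩
    M * c * ((R + 10) * (H * w)) ∎)
  where
  open ≤-Reasoning
  M = 4 * w
  X = M + H
  S = divisorPairs M H w c
  F = w * X + c + X
  instance
    M≢0 : NonZero M
    M≢0 = m*n≢0 4 w

  x∙yz : ∀ M c R Y → M * c * (R * Y) ≡ R * (M * c * Y)
  x∙yz = solve-∀
  expand : ∀ R c H w → R * ((c * H + w * (4 * w + H) + 4 * w * (4 * w + H)) * (w * (4 * w + H) + c + (4 * w + H)))
    ≡ R * (c * H) * (4 * (w * w)) + c * H * (w * (R * H) + c * R + R * (4 * w + H))
      + R * (5 * (w * (4 * w + H))) * (w * (4 * w + H) + c + (4 * w + H))
  expand = solve-∀
  collect : ∀ R c H w → R * (c * H) * (4 * (w * w)) + c * H * (w * (4 * w) + 4 * (w * w) + 4 * (w * w)) + 2 * (c * H) * (14 * (w * w))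
    ≡ 4 * w * c * ((R + 10) * (H * w))
  collect = solve-∀

  X≤5w : X ≤ 5 * w
  X≤5w = ≤-trans (+-monoʳ-≤ (4 * w) H≤w) (≤-reflexive (+-comm (4 * w) w))
  5w≤4w² : 5 * w ≤ 4 * (w * w)
  5w≤4w² = begin
    5 * w            ≤⟨ *-monoˡ-≤ w (≤-trans (m≤m*n 5 R) 5R≤4w) ⟩
    4 * w * w        ≡⟨ *-assoc 4 w w ⟩
    4 * (w * w)      ∎
  RX≤ : R * X ≤ 4 * (w * w)
  RX≤ = begin
    R * X            ≤⟨ *-monoʳ-≤ R X≤5w ⟩
    R * (5 * w)      ≡⟨ lemma R w ⟩
    5 * R * w        ≤⟨ *-monoˡ-≤ w 5R≤4w ⟩
    4 * w * w        ≡⟨ *-assoc 4 w w ⟩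
    4 * (w * w)      ∎
    where lemma : ∀ R w → R * (5 * w) ≡ 5 * R * w
          lemma = solve-∀
  R5wX≤ : R * (5 * (w * X)) ≤ 2 * (c * H)
  R5wX≤ = begin
    R * (5 * (w * X))          ≤⟨ *-monoʳ-≤ R (*-monoʳ-≤ 5 (*-monoʳ-≤ w X≤5w)) ⟩
    R * (5 * (w * (5 * w)))    ≤⟨ m≤m+n _ (7 * (w * w * R)) ⟩
    R * (5 * (w * (5 * w))) + 7 * (w * w * R) ≡⟨ lemma R w ⟩
    2 * (16 * (w * w) * R)     ≤⟨ *-monoʳ-≤ 2 far ⟩
    2 * (c * H)                ∎
    where lemma : ∀ R w → R * (5 * (w * (5 * w))) + 7 * (w * w * R) ≡ 2 * (16 * (w * w) * R)
          lemma = solve-∀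
  F≤ : F ≤ 14 * (w * w)
  F≤ = begin
    w * X + c + X                                  ≤⟨ +-mono-≤ (+-mono-≤ (*-monoʳ-≤ w X≤5w) (≤-trans (m≤m*n c R) near)) (≤-trans X≤5w 5w≤4w²) ⟩
    w * (5 * w) + 4 * (w * w) + 4 * (w * w)        ≤⟨ m≤m+n _ (w * w) ⟩
    w * (5 * w) + 4 * (w * w) + 4 * (w * w) + w * w ≡⟨ lemma w ⟩
    14 * (w * w)                                   ∎
    where lemma : ∀ w → w * (5 * w) + 4 * (w * w) + 4 * (w * w) + w * w ≡ 14 * (w * w)
          lemma = solve-∀

-- Close pairs from the variance over a window of moduli

primesIn : ℕ → ℕ → ℕ
primesIn M H = ∑[ i < H ] 𝟙 (oddPrime? (M + i))

closePairs : List ℕ → ℕ → ℕ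
closePairs B D = ∑[ a ∈ B ] ∑[ a' ∈ B ] 𝟙 (∣ a - a' ∣ <? D)

-- The sieve supplies (p - 1) / 2 consecutive missed residues, and `w≤empties` consumes 2 w - 1.
-- Since p - 1 is at most 1 + 2 q for the rounded half q, 4 w ≤ p gives 4 w ≤ 2 (q + 1).
half-window : ∀ p w → 4 * w ≤ p → w + w ≤ suc ((p ∸ 1) / 2)
half-window zero    zero    h = z≤n
half-window zero    (suc w) ()
half-window (suc p) w h = *-cancelˡ-≤ 2 (begin
  2 * (w + w)                 ≡⟨ double w ⟩
  4 * w                       ≤⟨ h ⟩
  suc p                       ≡⟨ cong suc (m≡m%n+[m/n]*n p 2) ⟩
  suc (p % 2 + p / 2 * 2)     ≤⟨ +-monoˡ-≤ (p / 2 * 2) (m%n<n p 2) ⟩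
  2 + p / 2 * 2               ≡⟨ cong (2 +_) (*-comm (p / 2) 2) ⟩
  2 + 2 * (p / 2)             ≡⟨ *-distribˡ-+ 2 1 (p / 2) ⟨
  2 * suc (p / 2)             ∎)
  where
  open ≤-Reasoning
  double : ∀ w → 2 * (w + w) ≡ 4 * w
  double = solve-∀

-- Moduli run over [4 w, 4 w + H), at least H / K of them odd primes, and `L` bounds the diameter of
-- `B`. The hypotheses `far` and `near` put every c in [D, L] within reach of
-- `divisorPairs-equidistributed`, with relative error 10 / R. The primes gain at least 1 / (5 K) of
-- the main term, and 100 K ≤ R keeps the error to at most half of that.
module Window
  (B : List ℕ) (w H R K D L : ℕ)
  .{{_ : NonZero w}} .{{_ : NonZero H}} .{{_ : NonZero R}} .{{_ : NonZero D}}
  (H≤w : H ≤ w) (RH≤4w : R * H ≤ 4 * w) (5R≤4w : 5 * R ≤ 4 * w) (100K≤R : 100 * K ≤ R)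
  (far : 16 * (w * w) * R ≤ D * H) (near : L * R ≤ 4 * (w * w))
  (diam : ∀ {a a'} → a ∈ B → a' ∈ B → ∣ a - a' ∣ ≤ L)
  (primes : H ≤ K * primesIn (4 * w) H)
  (miss : ∀ {p} → OddPrime p → 4 * w ≤ p → p < 4 * w + H → ∃[ s ] Misses B p s ((p ∸ 1) / 2))
  where

  open Variance B w

  M = 4 * w
  X = M + H
  y = w * n

  private instance
    M≢0 : NonZero M
    M≢0 = m*n≢0 4 w
    M+i≢0 : ∀ {i} → NonZero (M + i)
    M+i≢0 {i} = >-nonZero (≤-trans (>-nonZero⁻¹ M) (m≤m+n M i))

  w≤M : w ≤ M
  w≤M = m≤n*m w 4

  totalCorr : ℕ → ℕ → ℕ
  totalCorr a a' = ∑[ i < H ] corr (M + i) a a'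

  energy : ℕ
  energy = ∑[ a ∈ B ] ∑[ a' ∈ B ] totalCorr a a'

  -- Sum `variance` over the H moduli, bounding m y² by X y² and crediting only the primes with
  -- their at least w empty arcs. Then H X y² cancels: without the prime term this would be the
  -- Cauchy-Schwarz bound, so `w * primesIn M H` is the gain.
  energy-lower : y * y * (X * H + w * primesIn M H) ≤ X * X * energy
  energy-lower = +-cancelˡ-≤ (H * (X * (y * y))) _ _ (begin
    H * (X * (y * y)) + y * y * (X * H + w * primesIn M H)
      ≤⟨ +-monoʳ-≤ (H * (X * (y * y))) (*-monoʳ-≤ (y * y) (+-monoʳ-≤ (X * H) w*primes≤)) ⟩
    H * (X * (y * y)) + y * y * (X * H + (∑[ i < H ] empties (M + i)))
      ≡⟨ regroup H X y _ ⟩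
    H * (2 * X * y * y) + y * y * (∑[ i < H ] empties (M + i))
      ≡⟨ cong₂ _+_ (sym (∑<-const H (2 * X * y * y))) (*-distribˡ-∑ (y * y) (upTo H) _) ⟩
    (∑[ i < H ] 2 * X * y * y) + (∑[ i < H ] y * y * empties (M + i))
      ≡⟨ ∑-distrib-+ (upTo H) _ _ ⟨
    (∑[ i < H ] (2 * X * y * y + y * y * empties (M + i)))
      ≤⟨ ∑<-mono H (λ {i} i<H → ≤-trans (variance (M + i) X y) (≤-trans (+-monoʳ-≤ _ (*-monoˡ-≤ (y * y) (+-monoʳ-≤ M (<⇒≤ i<H)))) (≤-reflexive (+-comm _ (X * (y * y)))))) ⟩
    (∑[ i < H ] (X * (y * y) + X * X * (∑[ a ∈ B ] ∑[ a' ∈ B ] corr (M + i) a a')))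
      ≡⟨ ∑-distrib-+ (upTo H) _ _ ⟩
    (∑[ i < H ] X * (y * y)) + (∑[ i < H ] X * X * (∑[ a ∈ B ] ∑[ a' ∈ B ] corr (M + i) a a'))
      ≡⟨ cong₂ _+_ (∑<-const H (X * (y * y))) (trans (sym (*-distribˡ-∑ (X * X) (upTo H) _)) (cong (X * X *_) swap)) ⟩
    H * (X * (y * y)) + X * X * energy ∎)
    where
    open ≤-Reasoning
    regroup : ∀ H X y Z → H * (X * (y * y)) + y * y * (X * H + Z) ≡ H * (2 * X * y * y) + y * y * Z
    regroup = solve-∀
    swap : (∑[ i < H ] ∑[ a ∈ B ] ∑[ a' ∈ B ] corr (M + i) a a') ≡ energy
    swap = trans (∑-swap (upTo H) B _) (∑-cong B λ a → ∑-swap (upTo H) B _)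
    w*primes≤ : w * primesIn M H ≤ (∑[ i < H ] empties (M + i))
    w*primes≤ = begin
      w * primesIn M H                             ≡⟨ *-distribˡ-∑ w (upTo H) _ ⟩
      (∑[ i < H ] w * 𝟙 (oddPrime? (M + i)))       ≤⟨ ∑<-mono H (λ {i} i<H → one i<H (oddPrime? (M + i))) ⟩
      (∑[ i < H ] empties (M + i))                 ∎
      where
      one : ∀ {i} → i < H → (d : Dec (OddPrime (M + i))) → w * 𝟙 d ≤ empties (M + i)
      one i<H (no _) = ≤-trans (≤-reflexive (*-zeroʳ w)) z≤n
      one {i} i<H (yes op) with s , m ← miss op (m≤m+n M i) (+-monoʳ-< M i<H) =
        ≤-trans (≤-reflexive (*-identityʳ w))
          (w≤empties (M + i) s _ (≤-trans w≤M (m≤m+n M i)) (half-window (M + i) w (m≤m+n M i)) m)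

  totalCorr-close : ∀ a a' → totalCorr a a' ≤ H * w
  totalCorr-close a a' = ≤-trans (∑<-mono H (λ {i} _ → corr≤w (M + i) (≤-trans w≤M (m≤m+n M i)) a a')) (≤-reflexive (∑<-const H w))

  -- A coincidence a' + d + v' ≡ a' + v modulo m says m ∣ (d - v) + v'. For fixed v, summing over m
  -- and v' gives `divisorPairs` at c = d - v, and D + w ≤ d ensures that c is at least D.
  totalCorr-far : ∀ a' d → D + w ≤ d → d ≤ L → R * (X * totalCorr (a' + d) a') ≤ (R + 10) * (H * w) * w
  totalCorr-far a' d D+w≤d d≤L = begin
    R * (X * totalCorr (a' + d) a')
      ≤⟨ *-monoʳ-≤ R (*-monoʳ-≤ X switch) ⟩
    R * (X * (∑[ v < w ] divisorPairs M H w (d ∸ v)))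
      ≡⟨ trans (cong (R *_) (*-distribˡ-∑ X (upTo w) _)) (*-distribˡ-∑ R (upTo w) _) ⟩
    (∑[ v < w ] R * (X * divisorPairs M H w (d ∸ v)))
      ≤⟨ ∑<-mono w bound ⟩
    (∑[ v < w ] (R + 10) * (H * w))
      ≡⟨ trans (∑<-const w _) (*-comm w _) ⟩
    (R + 10) * (H * w) * w ∎
    where
    open ≤-Reasoning
    v≤d : ∀ {v} → v < w → v ≤ d
    v≤d v<w = ≤-trans (<⇒≤ v<w) (≤-trans (m≤n+m w D) D+w≤d)

    hit≤ : ∀ {v v'} m → v < w → hit m (a' + d + v') (a' + v) ≤ 𝟙 (m ∣? (d ∸ v + v'))
    hit≤ {v} {v'} m v<w = 𝟙-mono ((a' + d + v') ≈?[ m ] (a' + v)) (m ∣? (d ∸ v + v')) λ eq →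
      ≈⇒∣ m (d ∸ v + v') (a' + v) (trans (cong (modℕ m) (rearrange a' v (d ∸ v) v' (m∸n+n≡m (v≤d v<w)))) eq)
      where
      assoc : ∀ a v c v' → c + v' + (a + v) ≡ a + (c + v) + v'
      assoc = solve-∀
      rearrange : ∀ a v c v' → c + v ≡ d → c + v' + (a + v) ≡ a + d + v'
      rearrange a v c v' eq = trans (assoc a v c v') (cong (λ x → a + x + v') eq)

    switch : totalCorr (a' + d) a' ≤ (∑[ v < w ] divisorPairs M H w (d ∸ v))
    switch = begin
      totalCorr (a' + d) a'
        ≤⟨ ∑<-mono H (λ {i} _ → ∑<-mono w (λ v<w → ∑<-mono w (λ _ → hit≤ (M + i) v<w))) ⟩
      (∑[ i < H ] ∑[ v < w ] ∑[ v' < w ] 𝟙 ((M + i) ∣? (d ∸ v + v')))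
        ≡⟨ ∑-swap (upTo H) (upTo w) _ ⟩
      (∑[ v < w ] divisorPairs M H w (d ∸ v)) ∎

    bound : ∀ {v} → v < w → R * (X * divisorPairs M H w (d ∸ v)) ≤ (R + 10) * (H * w)
    bound {v} v<w = divisorPairs-equidistributed H w c R {{it}} {{>-nonZero (≤-trans (>-nonZero⁻¹ D) D≤c)}} {{it}} H≤w RH≤4w 5R≤4w
      (≤-trans far (*-monoˡ-≤ H D≤c))
      (≤-trans (*-monoˡ-≤ R (≤-trans (m∸n≤m d v) d≤L)) near)
      where
      c = d ∸ v
      D≤c : D ≤ c
      D≤c = m+n≤o⇒m≤o∸n D (≤-trans (+-monoʳ-≤ D (<⇒≤ v<w)) D+w≤d)

  totalCorr-sym : ∀ a a' → totalCorr a a' ≡ totalCorr a' a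
  totalCorr-sym a a' = ∑-cong (upTo H) λ i → corr-sym (M + i) a a'

  totalCorr-far′ : ∀ a a' → D + w ≤ ∣ a - a' ∣ → ∣ a - a' ∣ ≤ L → R * (X * totalCorr a a') ≤ (R + 10) * (H * w) * w
  totalCorr-far′ a a' lo hi with ≤-total a' a
  ... | inj₁ a'≤a with d , refl ← m≤n⇒∃[o]m+o≡n a'≤a =
    totalCorr-far a' d (subst (D + w ≤_) dist lo) (subst (_≤ L) dist hi)
    where dist : ∣ a' + d - a' ∣ ≡ d
          dist = trans (∣-∣-comm (a' + d) a') (∣m-m+n∣≡n a' d)
  ... | inj₂ a≤a' with d , refl ← m≤n⇒∃[o]m+o≡n a≤a' =
    subst (λ t → R * (X * t) ≤ (R + 10) * (H * w) * w) (totalCorr-sym (a + d) a)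
      (totalCorr-far a d (subst (D + w ≤_) dist lo) (subst (_≤ L) dist hi))
    where dist : ∣ a - a + d ∣ ≡ d
          dist = ∣m-m+n∣≡n a d

  -- Every pair is charged the equidistributed value, and close pairs are charged the trivial bound
  -- H w on top. The sum over pairs then separates into n² and `closePairs`.
  totalCorr-≤ : ∀ {a a'} → a ∈ B → a' ∈ B →
    R * (X * totalCorr a a') ≤ (R + 10) * (H * w) * w + R * (X * (H * w)) * 𝟙 (∣ a - a' ∣ <? D + w)
  totalCorr-≤ {a} {a'} a∈ a'∈ = split (∣ a - a' ∣ <? D + w)
    where
    split : (d : Dec (∣ a - a' ∣ < D + w)) →
      R * (X * totalCorr a a') ≤ (R + 10) * (H * w) * w + R * (X * (H * w)) * 𝟙 d
    split (yes _) = begin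
      R * (X * totalCorr a a')                         ≤⟨ *-monoʳ-≤ R (*-monoʳ-≤ X (totalCorr-close a a')) ⟩
      R * (X * (H * w))                                ≡⟨ *-identityʳ _ ⟨
      R * (X * (H * w)) * 1                            ≤⟨ m≤n+m _ _ ⟩
      (R + 10) * (H * w) * w + R * (X * (H * w)) * 1   ∎
      where open ≤-Reasoning
    split (no ≮) = ≤-trans (totalCorr-far′ a a' (≮⇒≥ ≮) (diam a∈ a'∈)) (m≤m+n _ _)

  energy-upper : R * (X * energy) ≤ n * (n * ((R + 10) * (H * w) * w)) + R * (X * (H * w)) * closePairs B (D + w)
  energy-upper = begin
    R * (X * energy)
      ≡⟨ cong (R *_) (trans (*-distribˡ-∑ X B _) (∑-cong B λ a → *-distribˡ-∑ X B _)) ⟩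
    R * (∑[ a ∈ B ] ∑[ a' ∈ B ] X * totalCorr a a')
      ≡⟨ trans (*-distribˡ-∑ R B _) (∑-cong B λ a → *-distribˡ-∑ R B _) ⟩
    (∑[ a ∈ B ] ∑[ a' ∈ B ] R * (X * totalCorr a a'))
      ≤⟨ ∑-mono B (λ a∈ → ∑-mono B (λ a'∈ → totalCorr-≤ a∈ a'∈)) ⟩
    (∑[ a ∈ B ] ∑[ a' ∈ B ] (U + V * 𝟙 (∣ a - a' ∣ <? D + w)))
      ≡⟨ ∑-cong B (λ a → trans (∑-distrib-+ B _ _) (cong₂ _+_ (∑-const B U) (sym (*-distribˡ-∑ V B _)))) ⟩
    (∑[ a ∈ B ] (n * U + V * (∑[ a' ∈ B ] 𝟙 (∣ a - a' ∣ <? D + w))))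
      ≡⟨ trans (∑-distrib-+ B _ _) (cong₂ _+_ (∑-const B (n * U)) (sym (*-distribˡ-∑ V B _))) ⟩
    n * (n * U) + V * closePairs B (D + w) ∎
    where
    open ≤-Reasoning
    U = (R + 10) * (H * w) * w
    V = R * (X * (H * w))

  -- The lower and upper bounds for `energy` share the main term K R y² X H. After it cancels, the
  -- gain from the primes must be matched by the error of equidistribution and by the close pairs.
  many-closePairs : n * n ≤ 50 * K * closePairs B (D + w)
  many-closePairs = *-cancelˡ-≤ (R * (w * w * w) * H) {{positive}}
    (+-cancelˡ-≤ (R * (w * H) * (y * y)) _ _ (begin
      R * (w * H) * (y * y) + R * (w * w * w) * H * (n * n)
        ≡⟨ step₁ R w H n ⟩
      -- Two copies of the gain: one absorbs the error by means of 100 K ≤ R, the other leaves n².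
      2 * (R * (y * y * (w * H)))
        ≤⟨ *-monoʳ-≤ 2 (+-cancelˡ-≤ (K * (R * (y * y * (X * H)))) _ _ combined) ⟩
      2 * (K * (10 * (X * H) * (y * y)) + K * (R * (X * X * (H * w)) * Cl))
        ≤⟨ *-monoʳ-≤ 2 (+-mono-≤ (*-monoʳ-≤ K (*-monoˡ-≤ (y * y) (*-monoʳ-≤ 10 (*-monoˡ-≤ H X≤5w))))
                                 (*-monoʳ-≤ K (*-monoˡ-≤ Cl (*-monoʳ-≤ R (*-monoˡ-≤ (H * w) (*-mono-≤ X≤5w X≤5w)))))) ⟩
      2 * (K * (10 * (5 * w * H) * (y * y)) + K * (R * (5 * w * (5 * w) * (H * w)) * Cl))
        ≡⟨ step₂ K w H (y * y) R Cl ⟩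
      100 * K * (w * H) * (y * y) + R * (w * w * w) * H * (50 * K * Cl)
        ≤⟨ +-monoˡ-≤ _ (*-monoˡ-≤ (y * y) (*-monoˡ-≤ (w * H) 100K≤R)) ⟩
      R * (w * H) * (y * y) + R * (w * w * w) * H * (50 * K * Cl) ∎))
    where
    open ≤-Reasoning
    positive : NonZero (R * (w * w * w) * H)
    positive = m*n≢0 (R * (w * w * w)) H {{m*n≢0 R (w * w * w) {{it}} {{m*n≢0 (w * w) w {{m*n≢0 w w}}}}}}
    Cl = closePairs B (D + w)
    π  = primesIn M H
    X≤5w : X ≤ 5 * w
    X≤5w = ≤-trans (+-monoʳ-≤ M H≤w) (≤-reflexive (+-comm M w))
    step₁ : ∀ R w H n → R * (w * H) * (w * n * (w * n)) + R * (w * w * w) * H * (n * n) ≡ 2 * (R * (w * n * (w * n) * (w * H)))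
    step₁ = solve-∀
    step₂ : ∀ K w H Y R C → 2 * (K * (10 * (5 * w * H) * Y) + K * (R * (5 * w * (5 * w) * (H * w)) * C))
      ≡ 100 * K * (w * H) * Y + R * (w * w * w) * H * (50 * K * C)
    step₂ = solve-∀
    step₃ : ∀ K R Y XH w P → K * (R * (Y * XH)) + R * (Y * (w * (K * P))) ≡ K * (R * (Y * (XH + w * P)))
    step₃ = solve-∀
    step₄ : ∀ K R X E → K * (R * (X * X * E)) ≡ K * (X * (R * (X * E)))
    step₄ = solve-∀
    step₅ : ∀ K R X H w n C → K * (X * (n * (n * ((R + 10) * (H * w) * w)) + R * (X * (H * w)) * C))
      ≡ K * (R * (w * n * (w * n) * (X * H))) + (K * (10 * (X * H) * (w * n * (w * n))) + K * (R * (X * X * (H * w)) * C))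
    step₅ = solve-∀
    combined : K * (R * (y * y * (X * H))) + R * (y * y * (w * H))
             ≤ K * (R * (y * y * (X * H))) + (K * (10 * (X * H) * (y * y)) + K * (R * (X * X * (H * w)) * Cl))
    combined = begin
      K * (R * (y * y * (X * H))) + R * (y * y * (w * H))
        ≤⟨ +-monoʳ-≤ (K * (R * (y * y * (X * H)))) (*-monoʳ-≤ R (*-monoʳ-≤ (y * y) (*-monoʳ-≤ w primes))) ⟩
      K * (R * (y * y * (X * H))) + R * (y * y * (w * (K * π)))
        ≡⟨ step₃ K R (y * y) (X * H) w π ⟩
      K * (R * (y * y * (X * H + w * π)))
        ≤⟨ *-monoʳ-≤ K (*-monoʳ-≤ R energy-lower) ⟩
      K * (R * (X * X * energy))
        ≡⟨ step₄ K R X energy ⟩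
      K * (X * (R * (X * energy)))
        ≤⟨ *-monoʳ-≤ K (*-monoʳ-≤ X energy-upper) ⟩
      K * (X * (n * (n * ((R + 10) * (H * w) * w)) + R * (X * (H * w)) * Cl))
        ≡⟨ step₅ K R X H w n Cl ⟩
      K * (R * (y * y * (X * H))) + (K * (10 * (X * H) * (y * y)) + K * (R * (X * X * (H * w)) * Cl)) ∎

-- Chebyshev's lower bound

n<m^n : ∀ m .{{_ : NonTrivial m}} n → n < m ^ n
n<m^n m zero    = z<s
n<m^n m (suc n) = begin
  2 + n          ≤⟨ +-monoʳ-≤ 2 (m≤m+n n n) ⟩
  2 + (n + n)    ≡⟨ double n ⟩
  2 * suc n      ≤⟨ *-mono-≤ (nonTrivial⇒n>1 m) (n<m^n m n) ⟩
  m * m ^ n      ∎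
  where
  open ≤-Reasoning
  double : ∀ n → 2 + (n + n) ≡ 2 * suc n
  double = solve-∀

^-∣ : ∀ m {i j} → i ≤ j → m ^ i ∣ m ^ j
^-∣ m {i} i≤j with k , refl ← m≤n⇒∃[o]m+o≡n i≤j = subst (m ^ i ∣_) (sym (^-distribˡ-+-* m i k)) (m∣m*n (m ^ k))

-- A downward search from the third argument for an exponent j with p^j ≤ n. Starting at n itself,
-- as `topPower` does, misses nothing for a prime p, since j < p^j.
maxExp : ℕ → ℕ → ℕ → ℕ
maxExp p n zero    = 0
maxExp p n (suc k) with p ^ suc k ≤? n
... | yes _ = suc k
... | no  _ = maxExp p n k

maxExp-≤ : ∀ p n .{{_ : NonZero n}} k → p ^ maxExp p n k ≤ n
maxExp-≤ p n zero = >-nonZero⁻¹ n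
maxExp-≤ p n (suc k) with p ^ suc k ≤? n
... | yes le = le
... | no  _  = maxExp-≤ p n k

maxExp-greatest : ∀ p n k {j} → j ≤ k → p ^ j ≤ n → j ≤ maxExp p n k
maxExp-greatest p n zero    j≤k _ = j≤k
maxExp-greatest p n (suc k) {j} j≤k le with p ^ suc k ≤? n
... | yes _ = j≤k
... | no ¬le = maxExp-greatest p n k (m<1+n⇒m≤n (≤∧≢⇒< j≤k λ { refl → ¬le le })) le

primesUpTo : ℕ → List ℕ
primesUpTo n = filter prime? (upTo (suc n))

topPower : ℕ → ℕ → ℕ
topPower n p = p ^ maxExp p n n

-- This is lcm(1, …, n).
topPowers : ℕ → ℕ
topPowers n = product (map (topPower n) (primesUpTo n))

product-≤ : ∀ {n} (f : ℕ → ℕ) (xs : List ℕ) → (∀ x → f x ≤ n) → product (map f xs) ≤ n ^ length xs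
product-≤ f []       h = ≤-refl
product-≤ f (x ∷ xs) h = *-mono-≤ (h x) (product-≤ f xs h)

topPowers≢0 : ∀ n → NonZero (topPowers n)
topPowers≢0 n = product≢0 (All.map⁺ (All.map (λ {p} pp → m^n≢0 p (maxExp p n n) {{prime⇒nonZero pp}}) (all-filter prime? (upTo (suc n)))))

topPowers-≤ : ∀ n .{{_ : NonZero n}} → topPowers n ≤ n ^ length (primesUpTo n)
topPowers-≤ n = product-≤ (topPower n) (primesUpTo n) (λ p → maxExp-≤ p n n)

primePower∣topPowers : ∀ n .{{_ : NonZero n}} {p} k → Prime p → p ^ k ≤ n → p ^ k ∣ topPowers n
primePower∣topPowers n zero          pp le = 1∣ _
primePower∣topPowers n {p} (suc k) pp le = ∣-trans
  (^-∣ p (maxExp-greatest p n n (<⇒≤ (≤-trans (n<m^n p (suc k)) le)) le))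
  (∈⇒∣product (∈-map⁺ (topPower n) (∈-filter⁺ prime? (∈-upTo⁺ (s≤s p≤n)) pp)))
  where
  instance
    p>1 : NonTrivial p
    p>1 = prime⇒nonTrivial pp
  p≤n : p ≤ n
  p≤n = ≤-trans (m≤m*n p (p ^ k) {{m^n≢0 p k {{nonTrivial⇒nonZero p}}}}) le

split-prime : ∀ {p} → Prime p → ∀ m .{{_ : NonZero m}} → ∃[ k ] ∃[ r ] (m ≡ r * p ^ k × ¬ p ∣ r)
split-prime {p} pp m = <-rec (λ m → NonZero m → ∃[ k ] ∃[ r ] (m ≡ r * p ^ k × ¬ p ∣ r)) step m (>-nonZero (>-nonZero⁻¹ m))
  where
  instance
    p>1 : NonTrivial p
    p>1 = prime⇒nonTrivial pp
  step : ∀ m → (∀ {q} → q < m → NonZero q → ∃[ k ] ∃[ r ] (q ≡ r * p ^ k × ¬ p ∣ r)) →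
         NonZero m → ∃[ k ] ∃[ r ] (m ≡ r * p ^ k × ¬ p ∣ r)
  step m rec m≢0 with p ∣? m
  ... | no ¬p∣m = 0 , m , sym (*-identityʳ m) , ¬p∣m
  ... | yes p∣m@(divides q m≡qp) with rec (quotient-< p∣m {{p>1}} {{m≢0}}) (quotient≢0 p∣m {{m≢0}})
  ...   | k , r , q≡ , ¬p∣r = suc k , r , trans m≡qp (trans (cong (_* p) q≡) (reassoc r (p ^ k) p)) , ¬p∣r
    where
    reassoc : ∀ r x p → r * x * p ≡ r * (p * x)
    reassoc = solve-∀

prime-coprime : ∀ {p r} → Prime p → ¬ p ∣ r → Coprime r p
prime-coprime pp ¬p∣r (d∣r , d∣p) with prime⇒irreducible pp d∣p
... | inj₁ d≡1 = d≡1
... | inj₂ refl = contradiction d∣r ¬p∣r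

∣-cancel-primePower : ∀ {p r q} → Prime p → ¬ p ∣ r → ∀ k → r ∣ q * p ^ k → r ∣ q
∣-cancel-primePower {p} {r} {q} pp ¬p∣r zero    r∣ = subst (r ∣_) (*-identityʳ q) r∣
∣-cancel-primePower {p} {r} {q} pp ¬p∣r (suc k) r∣ = ∣-cancel-primePower pp ¬p∣r k
  (coprime-divisor (prime-coprime pp ¬p∣r) (subst (r ∣_) (pull q p (p ^ k)) r∣))
  where
  pull : ∀ q p x → q * (p * x) ≡ p * (q * x)
  pull = solve-∀

-- Strong induction on m: split off the full power of a prime factor, m = r p^k. By hypothesis d = q
-- p^k, by induction r ∣ d, and r is coprime to p, so r ∣ q.
∣-by-primePowers : ∀ d m .{{_ : NonZero m}} → (∀ {p} k → Prime p → p ^ k ∣ m → p ^ k ∣ d) → m ∣ d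
∣-by-primePowers d m = <-rec (λ m → NonZero m → (∀ {p} k → Prime p → p ^ k ∣ m → p ^ k ∣ d) → m ∣ d) step m (>-nonZero (>-nonZero⁻¹ m))
  where
  step : ∀ m → (∀ {r} → r < m → NonZero r → (∀ {p} k → Prime p → p ^ k ∣ r → p ^ k ∣ d) → r ∣ d) →
         NonZero m → (∀ {p} k → Prime p → p ^ k ∣ m → p ^ k ∣ d) → m ∣ d
  step m rec m≢0 h with factorise m {{m≢0}}
  ... | record { factors = [] ; isFactorisation = refl } = 1∣ d
  ... | record { factors = p ∷ ps ; isFactorisation = m≡ ; factorsPrime = pp ∷ _ }
    with split-prime pp m {{m≢0}}
  ...   | zero  , r , m≡r , ¬p∣r = contradiction (subst (p ∣_) (trans (sym m≡) (trans m≡r (*-identityʳ r))) (m∣m*n (product ps))) ¬p∣r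
  ...   | suc k , r , m≡rpᵏ , ¬p∣r with h (suc k) pp (divides r m≡rpᵏ)
  ...     | divides q d≡qpᵏ = subst₂ _∣_ (sym m≡rpᵏ) (sym d≡qpᵏ) (*-monoˡ-∣ (p ^ suc k)
              (∣-cancel-primePower {q = q} pp ¬p∣r (suc k) (subst (r ∣_) d≡qpᵏ
                (rec {r} r<m r≢0 λ j pp′ ∣r → h j pp′ (∣-trans ∣r r∣m)))))
    where
    r∣m : r ∣ m
    r∣m = subst (r ∣_) (sym m≡rpᵏ) (m∣m*n (p ^ suc k))
    r≢0 : NonZero r
    r≢0 = ≢-nonZero λ { refl → ≢-nonZero⁻¹ m {{m≢0}} m≡rpᵏ }
    r<m : r < m
    r<m = subst (r <_) (sym m≡rpᵏ) (m<m*n r (p ^ suc k) {{r≢0}} (begin-strict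
      1              <⟨ s≤s z<s ⟩
      2 + k          ≤⟨ n<m^n p {{prime⇒nonTrivial pp}} (suc k) ⟩
      p ^ suc k      ∎))
      where open ≤-Reasoning

∣topPowers : ∀ n .{{_ : NonZero n}} m .{{_ : NonZero m}} → m ≤ n → m ∣ topPowers n
∣topPowers n m m≤n = ∣-by-primePowers (topPowers n) m λ k pp ∣m → primePower∣topPowers n k pp (≤-trans (∣⇒≤ ∣m) m≤n)

-- With 1/f(i,j) = i! j! / (i+j+1)!, the identity 1/f(i+1,j) = 1/f(i,j) - 1/f(i,j+1)
-- propagates integrality of d/f from the unit fractions 1/f(0,j) = 1/(j+1).
beta-integral : ∀ d n → (∀ m .{{_ : NonZero m}} → m ≤ n → m ∣ d) →
  ∀ i j → i + j < n → ∃[ e ] d * (i ! * j !) ≡ e * suc (i + j) !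
beta-integral d n h zero j j<n with divides e d≡ ← h (suc j) j<n = e , (begin
  d * (1 * j !)           ≡⟨ cong₂ _*_ d≡ (*-identityˡ (j !)) ⟩
  e * suc j * j !         ≡⟨ *-assoc e (suc j) (j !) ⟩
  e * (suc j * j !)       ∎)
  where open ≡-Reasoning
beta-integral d n h (suc i) j i+j<n
  with e₁ , eq₁ ← beta-integral d n h i j (<⇒≤ i+j<n)
     | e₂ , eq₂ ← beta-integral d n h i (suc j) (subst (_< n) (sym (+-suc i j)) i+j<n)
  -- The truncated subtraction loses nothing, since `key` exhibits e₁ F as e₂ F plus the required
  -- value.
  = e₁ ∸ e₂ , (begin
  d * (suc i ! * j !)                       ≡⟨ m+n∸m≡n (e₂ * F) _ ⟨
  e₂ * F + d * (suc i ! * j !) ∸ e₂ * F     ≡⟨ cong (_∸ e₂ * F) key ⟨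
  e₁ * F ∸ e₂ * F                           ≡⟨ *-distribʳ-∸ F e₁ e₂ ⟨
  (e₁ ∸ e₂) * F                             ∎)
  where
  open ≡-Reasoning
  F = suc (suc i + j) !
  split : ∀ d i j x y → suc (suc i + j) * (d * (x * y)) ≡ d * (x * (suc j * y)) + d * (suc i * x * y)
  split = solve-∀
  swap : ∀ e s x → e * (s * x) ≡ s * (e * x)
  swap = solve-∀
  key : e₁ * F ≡ e₂ * F + d * (suc i ! * j !)
  key = begin
    e₁ * (suc (suc i + j) * suc (i + j) !)          ≡⟨ swap e₁ (suc (suc i + j)) (suc (i + j) !) ⟩
    suc (suc i + j) * (e₁ * suc (i + j) !)          ≡⟨ cong (suc (suc i + j) *_) eq₁ ⟨
    suc (suc i + j) * (d * (i ! * j !))             ≡⟨ split d i j (i !) (j !) ⟩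
    d * (i ! * suc j !) + d * (suc i ! * j !)       ≡⟨ cong (_+ d * (suc i ! * j !)) eq₂ ⟩
    e₂ * suc (i + suc j) ! + d * (suc i ! * j !)    ≡⟨ cong (λ s → e₂ * suc s ! + d * (suc i ! * j !)) (+-suc i j) ⟩
    e₂ * F + d * (suc i ! * j !)                    ∎

-- Passing to k + 1 multiplies (2 k + 1)! / k!² by (2 k + 3) (2 k + 2) / (k + 1)² ≥ 2. The
-- polynomial 4 + 6 k + 2 k² is the surplus (2 k + 3) (2 k + 2) - 2 (k + 1)².
2^k*k!²≤ : ∀ k → 2 ^ k * (k ! * k !) ≤ suc (k + k) !
2^k*k!²≤ zero    = ≤-refl
2^k*k!²≤ (suc k) = begin
  2 ^ suc k * (suc k ! * suc k !)
    ≡⟨ regroup k (2 ^ k) (k !) ⟩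
  2 * (suc k * suc k) * (2 ^ k * (k ! * k !))
    ≤⟨ *-mono-≤ (m≤m+n (2 * (suc k * suc k)) (4 + 6 * k + 2 * (k * k))) (2^k*k!²≤ k) ⟩
  (2 * (suc k * suc k) + (4 + 6 * k + 2 * (k * k))) * suc (k + k) !
    ≡⟨ expand k (suc (k + k) !) ⟩
  (3 + (k + k)) * ((2 + (k + k)) * suc (k + k) !)
    ≡⟨ cong (λ s → suc (suc s) !) (+-suc k k) ⟨
  suc (suc k + suc k) ! ∎
  where
  open ≤-Reasoning
  regroup : ∀ k p f → 2 * p * (suc k * f * (suc k * f)) ≡ 2 * (suc k * suc k) * (p * (f * f))
  regroup = solve-∀
  expand : ∀ k f → (2 * (suc k * suc k) + (4 + 6 * k + 2 * (k * k))) * f ≡ (3 + (k + k)) * ((2 + (k + k)) * f)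
  expand = solve-∀

-- The number lcm(1, ..., 2 k + 1) k!² / (2 k + 1)! is an integer by `beta-integral`. Being
-- positive, it is at least 1.
topPowers-≥ : ∀ k → 2 ^ k ≤ topPowers (suc (k + k))
topPowers-≥ k with beta-integral d (suc (k + k)) (∣topPowers (suc (k + k))) k k ≤-refl
  where d = topPowers (suc (k + k))
... | zero , eq = contradiction eq (≢-nonZero⁻¹ (d * (k ! * k !)) {{m*n≢0 d _ {{d≢0}} {{k !* k !≢0}}}})
  where
  d = topPowers (suc (k + k))
  d≢0 : NonZero d
  d≢0 = topPowers≢0 (suc (k + k))
... | suc e , eq = *-cancelʳ-≤ (2 ^ k) _ (k ! * k !) {{k !* k !≢0}} (begin
  2 ^ k * (k ! * k !)         ≤⟨ 2^k*k!²≤ k ⟩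
  suc (k + k) !               ≤⟨ m≤m+n _ _ ⟩
  suc e * suc (k + k) !       ≡⟨ eq ⟨
  topPowers (suc (k + k)) * (k ! * k !) ∎)
  where open ≤-Reasoning

-- Compare exponents of 2 in 2^k ≤ lcm(1, ..., n) ≤ n^π, where k = 2^e - 1 and n = 2 k + 1 < 2^(e +
-- 1). The outer 1 comes from 2^e = k + 1, the inner `suc` from the prime 2, which `primesIn` omits.
chebyshev : ∀ e → 2 ^ e ≤ 1 + suc e * suc (primesIn 0 (2 ^ suc e))
chebyshev e = begin
  2 ^ e                ≡⟨ 2^e≡1+k ⟩
  suc k                ≤⟨ s≤s k≤ ⟩
  1 + suc e * π        ≤⟨ s≤s (*-monoʳ-≤ (suc e) π≤) ⟩
  1 + suc e * suc (primesIn 0 (2 ^ suc e)) ∎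
  where
  open ≤-Reasoning
  k = pred (2 ^ e)
  2^e≡1+k : 2 ^ e ≡ suc k
  2^e≡1+k = sym (suc-pred (2 ^ e) {{m^n≢0 2 e}})
  n = suc (k + k)
  1+n≡ : suc n ≡ 2 ^ suc e
  1+n≡ = trans (double k) (cong (2 *_) (sym 2^e≡1+k))
    where double : ∀ k → 2 + (k + k) ≡ 2 * suc k
          double = solve-∀
  π = length (primesUpTo n)
  2^k≤ : 2 ^ k ≤ 2 ^ (suc e * π)
  2^k≤ = begin
    2 ^ k               ≤⟨ topPowers-≥ k ⟩
    topPowers n         ≤⟨ topPowers-≤ n ⟩
    n ^ π               ≤⟨ ^-monoˡ-≤ π (≤-trans (n≤1+n n) (≤-reflexive 1+n≡)) ⟩
    (2 ^ suc e) ^ π     ≡⟨ ^-*-assoc 2 (suc e) π ⟩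
    2 ^ (suc e * π)     ∎
  k≤ : k ≤ suc e * π
  k≤ = ≮⇒≥ λ lt → <⇒≱ (^-monoʳ-< 2 ≤-refl lt) 2^k≤
  π≤ : π ≤ suc (primesIn 0 (2 ^ suc e))
  π≤ = begin
    π                                                  ≡⟨ length-filter-∑ prime? (upTo (suc n)) ⟩
    (∑[ i < suc n ] 𝟙 (prime? i))                      ≤⟨ ∑<-mono (suc n) (λ {i} _ → cover i) ⟩
    (∑[ i < suc n ] (𝟙 (i ≟ 2) + 𝟙 (oddPrime? i)))     ≡⟨ ∑-distrib-+ (upTo (suc n)) (λ i → 𝟙 (i ≟ 2)) (λ i → 𝟙 (oddPrime? i)) ⟩
    (∑[ i < suc n ] 𝟙 (i ≟ 2)) + primesIn 0 (suc n)    ≤⟨ +-monoˡ-≤ _ (∑<-unique (suc n) (_≟ 2) λ p q → trans p (sym q)) ⟩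
    suc (primesIn 0 (suc n))                           ≡⟨ cong (suc ∘ primesIn 0) 1+n≡ ⟩
    suc (primesIn 0 (2 ^ suc e))                       ∎
    where
    cover : ∀ i → 𝟙 (prime? i) ≤ 𝟙 (i ≟ 2) + 𝟙 (oddPrime? i)
    cover i = 𝟙-≤ (prime? i) λ pp → split pp (i ≟ 2)
      where
      split : Prime i → (d : Dec (i ≡ 2)) → 1 ≤ 𝟙 d + 𝟙 (oddPrime? i)
      split pp (yes _)  = s≤s z≤n
      split pp (no i≢2) = ≤-reflexive (sym (𝟙-yes (oddPrime? i) (pp , i≢2)))

-- Concentration of sieved sets

-- In twice the inequality `chebyshev`, the part 2 (e + 2) is at most 8 (e + 1) ≤ 2^l ≤ 2^e, which
-- leaves 2^e ≤ 2 (e + 1) π. The left side is twice the length 2^(e + 1) of the range, so that it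
-- also pays for the windows discarded in `dense-window`.
primes-dense : ∀ l e → 8 * suc e ≤ 2 ^ l → l ≤ e → 4 * 2 ^ e ≤ 2 ^ l * primesIn 0 (2 ^ suc e)
primes-dense l e 8E≤2^l l≤e = begin
  4 * 2 ^ e                ≤⟨ *-monoʳ-≤ 4 2^e≤ ⟩
  4 * (2 * (suc e * π))    ≡⟨ reassoc (suc e) π ⟩
  8 * suc e * π            ≤⟨ *-monoˡ-≤ π 8E≤2^l ⟩
  2 ^ l * π                ∎
  where
  open ≤-Reasoning
  π = primesIn 0 (2 ^ suc e)
  reassoc : ∀ E π → 4 * (2 * (E * π)) ≡ 8 * E * π
  reassoc = solve-∀
  spare : ∀ e → 2 * (2 + e) + (4 + 6 * e) ≡ 8 * suc e
  spare = solve-∀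
  expand : ∀ e π → 2 * (1 + suc e * suc π) ≡ 2 * (2 + e) + 2 * (suc e * π)
  expand = solve-∀
  2^e≤ : 2 ^ e ≤ 2 * (suc e * π)
  2^e≤ = +-cancelˡ-≤ (2 ^ e) _ _ (begin
    2 ^ e + 2 ^ e                          ≡⟨ cong (2 ^ e +_) (+-identityʳ (2 ^ e)) ⟨
    2 * 2 ^ e                              ≤⟨ *-monoʳ-≤ 2 (chebyshev e) ⟩
    2 * (1 + suc e * suc π)                ≡⟨ expand e π ⟩
    2 * (2 + e) + 2 * (suc e * π)          ≤⟨ +-monoˡ-≤ _ (m≤m+n (2 * (2 + e)) (4 + 6 * e)) ⟩
    2 * (2 + e) + (4 + 6 * e) + 2 * (suc e * π) ≡⟨ cong (_+ 2 * (suc e * π)) (spare e) ⟩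
    8 * suc e + 2 * (suc e * π)            ≤⟨ +-monoˡ-≤ _ (≤-trans 8E≤2^l (^-monoʳ-≤ 2 l≤e)) ⟩
    2 ^ e + 2 * (suc e * π)                ∎)

-- The windows [j H, (j + 1) H) with j < J are too short in total to hold all the primes.
dense-window : ∀ K J W H → J < W → K * (J * H) + W * H ≤ K * primesIn 0 (W * H) →
  ∃[ j ] (J ≤ j × j < W × H ≤ K * primesIn (j * H) H)
dense-window K J W H J<W h = found (∑-pigeonhole (upTo (W ∸ J)) (λ j → K * primesIn ((J + j) * H) H) H
         (subst (0 <_) (sym (length-upTo (W ∸ J))) (m<n⇒0<n∸m J<W)) enough)
  where
  found : ∃[ j ] (j ∈ upTo (W ∸ J) × H ≤ K * primesIn ((J + j) * H) H) → ∃[ j ] (J ≤ j × j < W × H ≤ K * primesIn (j * H) H)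
  found (j , j∈ , H≤) = J + j , m≤m+n J j , subst (J + j <_) (m+[n∸m]≡n (<⇒≤ J<W)) (+-monoʳ-< J (∈-upTo⁻ j∈)) , H≤
  open ≤-Reasoning
  enough : length (upTo (W ∸ J)) * H ≤ (∑[ j < W ∸ J ] K * primesIn ((J + j) * H) H)
  enough = +-cancelˡ-≤ (K * (J * H)) _ _ (begin
    K * (J * H) + length (upTo (W ∸ J)) * H
      ≡⟨ cong (λ x → K * (J * H) + x * H) (length-upTo (W ∸ J)) ⟩
    K * (J * H) + (W ∸ J) * H
      ≤⟨ +-monoʳ-≤ (K * (J * H)) (*-monoˡ-≤ H (m∸n≤m W J)) ⟩
    K * (J * H) + W * H
      ≤⟨ h ⟩
    K * primesIn 0 (W * H)
      ≡⟨ cong (K *_) (∑<-* W H _) ⟩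
    K * (∑[ j < W ] primesIn (j * H) H)
      ≡⟨ cong (λ W → K * (∑[ j < W ] primesIn (j * H) H)) (m+[n∸m]≡n (<⇒≤ J<W)) ⟨
    K * (∑[ j < J + (W ∸ J) ] primesIn (j * H) H)
      ≡⟨ trans (cong (K *_) (∑<-+ J (W ∸ J) _)) (*-distribˡ-+ K _ _) ⟩
    K * (∑[ j < J ] primesIn (j * H) H) + K * (∑[ j < W ∸ J ] primesIn ((J + j) * H) H)
      ≤⟨ +-mono-≤ (*-monoʳ-≤ K (≤-trans (∑<-mono J (λ {j} _ → primesIn≤ (j * H))) (≤-reflexive (∑<-const J H))))
                  (≤-reflexive (*-distribˡ-∑ K (upTo (W ∸ J)) _)) ⟩
    K * (J * H) + (∑[ j < W ∸ J ] K * primesIn ((J + j) * H) H) ∎)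
    where
    primesIn≤ : ∀ M → primesIn M H ≤ H
    primesIn≤ M = ≤-trans (∑<-mono H λ {i} _ → 𝟙≤1 (oddPrime? (M + i))) (≤-reflexive (trans (∑<-const H 1) (*-identityʳ H)))

closePairs-mono : ∀ B {D D'} → D ≤ D' → closePairs B D ≤ closePairs B D'
closePairs-mono B {D} {D'} D≤D' = ∑-mono B λ {a} _ → ∑-mono B λ {a'} _ →
  𝟙-mono (∣ a - a' ∣ <? D) (∣ a - a' ∣ <? D') λ lt → <-≤-trans lt D≤D'

near : List ℕ → ℕ → ℕ → List ℕ
near B D a = filter (λ a' → ∣ a - a' ∣ <? D) B

2^-* : ∀ i j {k} → i + j ≡ k → 2 ^ i * 2 ^ j ≡ 2 ^ k
2^-* i j eq = trans (sym (^-distribˡ-+-* 2 i j)) (cong (2 ^_) eq)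

-- Average the close pairs over their first coordinate. For empty `B` the centre 0 is a dummy.
closePairs-popular : ∀ B D k → length B * length B ≤ k * closePairs B D → ∃[ a ] length B ≤ k * length (near B D a)
closePairs-popular []        D k h = 0 , z≤n
closePairs-popular B@(_ ∷ _) D k h
  with a , _ , le ← ∑-pigeonhole B (λ a → k * (∑[ a' ∈ B ] 𝟙 (∣ a - a' ∣ <? D))) (length B) z<s
                      (≤-trans h (≤-reflexive (*-distribˡ-∑ k B _)))
  = a , ≤-trans le (≤-reflexive (cong (k *_) (sym (length-filter-∑ (λ a' → ∣ a - a' ∣ <? D) B))))

Sieved : List ℕ → ℕ → Set
Sieved B P = ∀ {p} → OddPrime p → p < P → ∃[ s ] Misses B p s ((p ∸ 1) / 2)

-- In terms of z = 2 ^ l and P = 2 ^ (2 + g + 3 * l): at the cost of a factor z², the diameter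
-- drops from P² / z⁵ to about P z⁵.
concentration : ∀ l g B → 7 ≤ l → 1 ≤ g → 8 * (2 + g + 3 * l) ≤ 2 ^ l →
  Sieved B (2 ^ (2 + g + 3 * l)) →
  (∀ {a a'} → a ∈ B → a' ∈ B → ∣ a - a' ∣ ≤ 2 ^ (4 + 2 * g + l)) →
  ∃[ a ] length B ≤ 2 ^ (2 * l) * length (near B (2 ^ (3 + g + 8 * l)) a)
concentration l g B 7≤l 1≤g 8E≤ sieved diam = from-window (dense-window K J W H J<W enough)
  where
  open ≤-Reasoning
  -- With z = 2^l: K = z is the inverse density of primes, J = z² is both the accuracy R and the
  -- number of discarded windows, and W = z³ windows of length H fill up P. Since H = 4 G, the j-th
  -- window starts at 4 w with w = j G.
  K = 2 ^ l
  J = 2 ^ (2 * l)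
  W = 2 ^ (3 * l)
  G = 2 ^ g
  H = 4 * G
  l≤3l : l ≤ 3 * l
  l≤3l = m≤n*m l 3
  J<W : J < W
  J<W = ^-monoʳ-< 2 ≤-refl (*-monoˡ-< l {{>-nonZero (≤-trans (s≤s z≤n) 7≤l)}} {2} {3} ≤-refl)
  WH≡ : W * H ≡ 2 ^ (2 + g + 3 * l)
  WH≡ = trans (cong (W *_) (2^-* 2 g refl)) (2^-* (3 * l) (2 + g) (+-comm (3 * l) (2 + g)))
  KJ≡W : K * J ≡ W
  KJ≡W = 2^-* l (2 * l) refl
  enough : K * (J * H) + W * H ≤ K * primesIn 0 (W * H)
  enough = begin
    K * (J * H) + W * H         ≡⟨ cong (_+ W * H) (trans (sym (*-assoc K J H)) (cong (_* H) KJ≡W)) ⟩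
    W * H + W * H               ≡⟨ cong (λ x → x + x) WH≡ ⟩
    2 * P' + 2 * P'             ≡⟨ double P' ⟩
    4 * P'                      ≤⟨ primes-dense l (1 + g + 3 * l) 8E≤ (≤-trans l≤3l (m≤n+m _ (1 + g))) ⟩
    K * primesIn 0 (2 * P')     ≡⟨ cong (λ x → K * primesIn 0 x) WH≡ ⟨
    K * primesIn 0 (W * H)      ∎
    where
    P' = 2 ^ (1 + g + 3 * l)
    double : ∀ x → 2 * x + 2 * x ≡ 4 * x
    double = solve-∀
  100≤K : 100 ≤ K
  100≤K = ≤-trans (m≤m+n 100 28) (^-monoʳ-≤ 2 7≤l)
  100K≤J : 100 * K ≤ J
  100K≤J = ≤-trans (*-monoˡ-≤ K 100≤K) (≤-reflexive (2^-* l l (cong (l +_) (sym (+-identityʳ l)))))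
  2^-≢0 : ∀ k → NonZero (2 ^ k)
  2^-≢0 k = m^n≢0 2 k
  -- This is 4 W² J G, the value at which `far` holds for the largest w, namely W G. Doubling it to
  -- `D` makes room for the extra w in D₀ + w.
  D₀ = 2 ^ (2 + g + 8 * l)
  D  = 2 ^ (3 + g + 8 * l)

  from-window : ∃[ j ] (J ≤ j × j < W × H ≤ K * primesIn (j * H) H) → ∃[ a ] length B ≤ J * length (near B D a)
  from-window (j , J≤j , j<W , primes) = closePairs-popular B D J (begin
    length B * length B                  ≤⟨ many-closePairs ⟩
    -- The loss 50 K is rounded up to J = z², which is possible because z ≥ 100.
    50 * K * closePairs B (D₀ + w)       ≤⟨ *-mono-≤ (≤-trans (*-monoˡ-≤ K (m≤m+n 50 50)) 100K≤J) (closePairs-mono B D₀+w≤D) ⟩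
    J * closePairs B D                   ∎)
    where
    w = j * G
    jH≡4w : j * H ≡ 4 * w
    jH≡4w = swap j 4 G
      where swap : ∀ j c G → j * (c * G) ≡ c * (j * G)
            swap = solve-∀
    w≥ : J * G ≤ w
    w≥ = *-monoˡ-≤ G J≤j
    w≤ : w ≤ W * G
    w≤ = *-monoˡ-≤ G (<⇒≤ j<W)
    instance
      G≢0 : NonZero G
      G≢0 = 2^-≢0 g
      J≢0 : NonZero J
      J≢0 = 2^-≢0 (2 * l)
      D₀≢0 : NonZero D₀
      D₀≢0 = 2^-≢0 (2 + g + 8 * l)
      H≢0 : NonZero H
      H≢0 = m*n≢0 4 G
      w≢0 : NonZero w
      w≢0 = >-nonZero (≤-trans (>-nonZero⁻¹ (J * G) {{m*n≢0 J G}}) w≥)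
    H≤w : H ≤ w
    H≤w = *-monoˡ-≤ G (≤-trans (≤-trans (≤-trans (m≤m+n 4 96) (m≤m*n 100 K {{2^-≢0 l}})) 100K≤J) J≤j)
    JH≤4w : J * H ≤ 4 * w
    JH≤4w = ≤-trans (*-monoˡ-≤ H J≤j) (≤-reflexive jH≡4w)
    5J≤4w : 5 * J ≤ 4 * w
    5J≤4w = begin
      5 * J          ≤⟨ *-monoˡ-≤ J (m≤m+n 5 3) ⟩
      8 * J          ≡⟨ swap J ⟩
      4 * (J * 2)    ≤⟨ *-monoʳ-≤ 4 (*-mono-≤ J≤j (^-monoʳ-≤ 2 1≤g)) ⟩
      4 * w          ∎
      where swap : ∀ J → 8 * J ≡ 4 * (J * 2)
            swap = solve-∀
    WWJG≡ : 4 * (W * W * J * G) ≡ D₀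
    WWJG≡ = begin-equality
      4 * (W * W * J * G)                          ≡⟨ cong (λ x → 4 * (x * J * G)) (2^-* (3 * l) (3 * l) refl) ⟩
      4 * (2 ^ (3 * l + 3 * l) * J * G)            ≡⟨ cong (λ x → 4 * (x * G)) (2^-* (3 * l + 3 * l) (2 * l) refl) ⟩
      4 * (2 ^ (3 * l + 3 * l + 2 * l) * G)        ≡⟨ cong (4 *_) (2^-* (3 * l + 3 * l + 2 * l) g refl) ⟩
      4 * 2 ^ (3 * l + 3 * l + 2 * l + g)          ≡⟨ 2^-* 2 (3 * l + 3 * l + 2 * l + g) (exponents l g) ⟩
      D₀                                           ∎
      where exponents : ∀ l g → 2 + (3 * l + 3 * l + 2 * l + g) ≡ 2 + g + 8 * l
            exponents = solve-∀
    far : 16 * (w * w) * J ≤ D₀ * H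
    far = begin
      16 * (w * w) * J                    ≤⟨ *-monoˡ-≤ J (*-monoʳ-≤ 16 (*-mono-≤ w≤ w≤)) ⟩
      16 * (W * G * (W * G)) * J          ≡⟨ regroup W G J ⟩
      4 * (W * W * J * G) * H             ≡⟨ cong (_* H) WWJG≡ ⟩
      D₀ * H                              ∎
      where regroup : ∀ W G J → 16 * (W * G * (W * G)) * J ≡ 4 * (W * W * J * G) * (4 * G)
            regroup = solve-∀
    -- The smallest w is J G, so the claim reduces to 4 + 2 g + 3 l ≤ 2 + 2 g + 4 l.
    narrow : 2 ^ (4 + 2 * g + l) * J ≤ 4 * (w * w)
    narrow = begin
      2 ^ (4 + 2 * g + l) * J                    ≡⟨ 2^-* (4 + 2 * g + l) (2 * l) (exponents₁ g l) ⟩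
      2 ^ (2 + 2 * g + 3 * l + 2)                ≤⟨ ^-monoʳ-≤ 2 (+-monoʳ-≤ (2 + 2 * g + 3 * l) (≤-trans (m≤m+n 2 5) 7≤l)) ⟩
      2 ^ (2 + 2 * g + 3 * l + l)                ≡⟨ cong (2 ^_) (exponents₂ g l) ⟩
      2 ^ (2 + (2 * l + g + (2 * l + g)))        ≡⟨ 2^-* 2 (2 * l + g + (2 * l + g)) refl ⟨
      4 * 2 ^ (2 * l + g + (2 * l + g))          ≡⟨ cong (4 *_) (2^-* (2 * l + g) (2 * l + g) refl) ⟨
      4 * (2 ^ (2 * l + g) * 2 ^ (2 * l + g))    ≡⟨ cong (λ x → 4 * (x * x)) (2^-* (2 * l) g refl) ⟨
      4 * (J * G * (J * G))                      ≤⟨ *-monoʳ-≤ 4 (*-mono-≤ w≥ w≥) ⟩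
      4 * (w * w)                                ∎
      where exponents₁ : ∀ g l → 4 + 2 * g + l + 2 * l ≡ 2 + 2 * g + 3 * l + 2
            exponents₁ = solve-∀
            exponents₂ : ∀ g l → 2 + 2 * g + 3 * l + l ≡ 2 + (2 * l + g + (2 * l + g))
            exponents₂ = solve-∀
    D₀+w≤D : D₀ + w ≤ D
    D₀+w≤D = +-monoʳ-≤ D₀ (begin
      w                        ≤⟨ w≤ ⟩
      W * G                    ≤⟨ m≤n*m (W * G) (4 * (W * J)) {{m*n≢0 4 (W * J) {{it}} {{m*n≢0 W J {{2^-≢0 (3 * l)}}}}}} ⟩
      4 * (W * J) * (W * G)    ≡⟨ regroup W G J ⟩
      4 * (W * W * J * G)      ≡⟨ WWJG≡ ⟩
      D₀                       ≡⟨ +-identityʳ D₀ ⟨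
      D₀ + 0                   ∎)
      where regroup : ∀ W G J → 4 * (W * J) * (W * G) ≡ 4 * (W * W * J * G)
            regroup = solve-∀
    miss : ∀ {p} → OddPrime p → 4 * w ≤ p → p < 4 * w + H → ∃[ s ] Misses B p s ((p ∸ 1) / 2)
    miss op _ p< = sieved op (≤-trans p< (begin
      4 * w + H                ≡⟨ cong (_+ H) jH≡4w ⟨
      j * H + H                ≡⟨ +-comm (j * H) H ⟩
      suc j * H                ≤⟨ *-monoˡ-≤ H j<W ⟩
      W * H                    ≡⟨ WH≡ ⟩
      2 ^ (2 + g + 3 * l)      ∎))
    open Window B w H J K D₀ (2 ^ (4 + 2 * g + l)) H≤w JH≤4w 5J≤4w 100K≤J far narrow diam
           (subst (λ M → H ≤ K * primesIn M H) jH≡4w primes) miss using (many-closePairs)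

-- Iterating the concentration

-- Stated through multiplicities, so that `length-≤-interval` follows by exchanging two sums.
Distinct : List ℕ → Set
Distinct B = ∀ u → (∑[ a ∈ B ] 𝟙 (a ≟ u)) ≤ 1

Distinct-filter : ∀ {P : ℕ → Set} (P? : Decidable P) {B} → Distinct B → Distinct (filter P? B)
Distinct-filter P? {B} distinct u = ≤-trans (∑-filter-≤ P? B _) (distinct u)

length-≤-interval : ∀ {B} x n → Distinct B → (∀ {a} → a ∈ B → x ≤ a × a < x + n) → length B ≤ n
length-≤-interval {B} x n distinct inside = begin
  length B                                 ≡⟨ *-identityʳ (length B) ⟨
  length B * 1                             ≡⟨ ∑-const B 1 ⟨
  (∑[ a ∈ B ] 1)                           ≤⟨ ∑-mono B covered ⟩
  (∑[ a ∈ B ] ∑[ i < n ] 𝟙 (a ≟ x + i))    ≡⟨ ∑-swap B (upTo n) _ ⟩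
  (∑[ i < n ] ∑[ a ∈ B ] 𝟙 (a ≟ x + i))    ≤⟨ ∑<-mono n (λ {i} _ → distinct (x + i)) ⟩
  (∑[ i < n ] 1)                           ≡⟨ ∑<-const n 1 ⟩
  n * 1                                    ≡⟨ *-identityʳ n ⟩
  n                                        ∎
  where
  open ≤-Reasoning
  covered : ∀ {a} → a ∈ B → 1 ≤ (∑[ i < n ] 𝟙 (a ≟ x + i))
  covered {a} a∈ with x≤a , a<x+n ← inside a∈ with i , refl ← m≤n⇒∃[o]m+o≡n x≤a =
    ≤-trans (≤-reflexive (sym (𝟙-yes (x + i ≟ x + i) refl))) (term≤∑ (λ j → 𝟙 (x + i ≟ x + j)) (∈-upTo⁺ (+-cancelˡ-< x i n a<x+n)))

near-length : ∀ {B} D a → Distinct B → length (near B D a) ≤ D + D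
-- If a < D, the truncated left end is 0, and [0, 2 D) still contains all neighbours.
near-length {B} D a distinct = length-≤-interval (a ∸ D) (D + D) (Distinct-filter (λ a' → ∣ a - a' ∣ <? D) {B} distinct) inside
  where
  open ≤-Reasoning
  inside : ∀ {b} → b ∈ near B D a → a ∸ D ≤ b × b < a ∸ D + (D + D)
  inside {b} b∈ = m≤n+o⇒m∸n≤o a D (begin
      a                      ≤⟨ m≤n+∣m-n∣ a b ⟩
      b + ∣ a - b ∣          ≤⟨ +-monoʳ-≤ b (<⇒≤ close) ⟩
      b + D                  ≡⟨ +-comm b D ⟩
      D + b                  ∎) , (begin-strict
      b                      ≤⟨ m≤n+∣n-m∣ b a ⟩
      a + ∣ a - b ∣          <⟨ +-monoʳ-< a close ⟩
      a + D                  ≤⟨ +-monoˡ-≤ D (m≤n+m∸n a D) ⟩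
      D + (a ∸ D) + D        ≡⟨ rearrange D (a ∸ D) ⟩
      a ∸ D + (D + D)        ∎)
    where
    close : ∣ a - b ∣ < D
    close = proj₂ (∈-filter⁻ (λ a' → ∣ a - a' ∣ <? D) {xs = B} b∈)
    rearrange : ∀ D x → D + x + D ≡ x + (D + D)
    rearrange = solve-∀

near-diameter : ∀ {B} D a {b b'} → b ∈ near B D a → b' ∈ near B D a → ∣ b - b' ∣ ≤ D + D
near-diameter {B} D a {b} {b'} b∈ b'∈ = begin
  ∣ b - b' ∣                  ≤⟨ ∣-∣-triangle b a b' ⟩
  ∣ b - a ∣ + ∣ a - b' ∣      ≡⟨ cong (_+ ∣ a - b' ∣) (∣-∣-comm b a) ⟩
  ∣ a - b ∣ + ∣ a - b' ∣      ≤⟨ +-mono-≤ (<⇒≤ (close b∈)) (<⇒≤ (close b'∈)) ⟩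
  D + D                       ∎
  where
  open ≤-Reasoning
  close : ∀ {b} → b ∈ near B D a → ∣ a - b ∣ < D
  close b∈ = proj₂ (∈-filter⁻ (λ a' → ∣ a - a' ∣ <? D) {xs = B} b∈)

Sieved-⊆ : ∀ {B B' P P'} → (∀ {a} → a ∈ B' → a ∈ B) → P' ≤ P → Sieved B P → Sieved B' P'
Sieved-⊆ sub P'≤P sieved op p<P' with s , miss ← sieved op (<-≤-trans p<P' P'≤P) = s , miss ∘ sub

block : List ℕ → (L : ℕ) .{{_ : NonZero L}} → ℕ → List ℕ
block B L j = filter (λ a → a / L ≟ j) B

popular-block : ∀ B V L .{{_ : NonZero V}} .{{_ : NonZero L}} → (∀ {a} → a ∈ B → a < V * L) →
  ∃[ j ] length B ≤ V * length (block B L j)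
popular-block B V L bounded with ∑-pigeonhole (upTo V) (λ j → V * length (block B L j)) (length B)
                                   (subst (0 <_) (sym (length-upTo V)) (>-nonZero⁻¹ V)) all-blocks
  where
  open ≤-Reasoning
  covered : ∀ {a} → a ∈ B → 1 ≤ (∑[ j < V ] 𝟙 (a / L ≟ j))
  covered {a} a∈ = ≤-trans (≤-reflexive (sym (𝟙-yes (a / L ≟ a / L) refl)))
    (term≤∑ (λ j → 𝟙 (a / L ≟ j)) (∈-upTo⁺ (m<n*o⇒m/o<n {a} {V} {L} (bounded a∈))))
  all-blocks : length (upTo V) * length B ≤ (∑[ j < V ] V * length (block B L j))
  all-blocks = begin
    length (upTo V) * length B                        ≡⟨ cong₂ _*_ (length-upTo V) (sym (trans (∑-const B 1) (*-identityʳ (length B)))) ⟩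
    V * (∑[ a ∈ B ] 1)                                ≤⟨ *-monoʳ-≤ V (∑-mono B covered) ⟩
    V * (∑[ a ∈ B ] ∑[ j < V ] 𝟙 (a / L ≟ j))         ≡⟨ cong (V *_) (∑-swap B (upTo V) _) ⟩
    V * (∑[ j < V ] ∑[ a ∈ B ] 𝟙 (a / L ≟ j))         ≡⟨ cong (V *_) (∑-cong (upTo V) λ j → length-filter-∑ (λ a → a / L ≟ j) B) ⟨
    V * (∑[ j < V ] length (block B L j))             ≡⟨ *-distribˡ-∑ V (upTo V) _ ⟩
    (∑[ j < V ] V * length (block B L j))             ∎
... | j , _ , le = j , le

block-diameter : ∀ {B} L .{{_ : NonZero L}} j {a a'} → a ∈ block B L j → a' ∈ block B L j → ∣ a - a' ∣ ≤ L
block-diameter {B} L j {a} {a'} a∈ a'∈ = begin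
  ∣ a - a' ∣                            ≡⟨ cong₂ ∣_-_∣ (decompose a∈) (decompose a'∈) ⟩
  ∣ j * L + a % L - j * L + a' % L ∣    ≡⟨ ∣m+n-m+o∣≡∣n-o∣ (j * L) (a % L) (a' % L) ⟩
  ∣ a % L - a' % L ∣                    ≤⟨ ∣m-n∣≤m⊔n (a % L) (a' % L) ⟩
  a % L ⊔ a' % L                        ≤⟨ ⊔-lub (m%n≤n a L) (m%n≤n a' L) ⟩
  L                                     ∎
  where
  open ≤-Reasoning
  decompose : ∀ {a} → a ∈ block B L j → a ≡ j * L + a % L
  decompose {a} a∈ = trans (m≡m%n+[m/n]*n a L) (trans (+-comm (a % L) _)
    (cong (λ q → q * L + a % L) (proj₂ (∈-filter⁻ (λ a → a / L ≟ j) {xs = B} a∈))))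

-- The losses are 2^V for restricting to one block, z² for each concentration, and 2 D₂ for counting
-- what remains trivially. The condition g₁ + 8 l ≤ 2 g₂ + l makes the diameter 2 D₁ after the first
-- round admissible for the second.
two-steps : ∀ l g₁ g₂ V B → 7 ≤ l → 1 ≤ g₂ → g₂ ≤ g₁ → g₁ + 8 * l ≤ 2 * g₂ + l →
  8 * (2 + g₁ + 3 * l) ≤ 2 ^ l → Sieved B (2 ^ (2 + g₁ + 3 * l)) → Distinct B →
  (∀ {a} → a ∈ B → a < 2 ^ (V + (4 + 2 * g₁ + l))) →
  length B ≤ 2 ^ (V + (4 + g₂ + 12 * l))
two-steps l g₁ g₂ V B 7≤l 1≤g₂ g₂≤g₁ g₁≤ 8E≤ sieved distinct bounded = conclude
  (popular-block B (2 ^ V) L {{2^≢0 V}} {{L≢0}} λ a∈ → subst (_ <_) (sym (2^-* V (4 + 2 * g₁ + l) refl)) (bounded a∈))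
  where
  2^≢0 : ∀ k → NonZero (2 ^ k)
  2^≢0 k = m^n≢0 2 k
  E≤ : 2 + g₂ + 3 * l ≤ 2 + g₁ + 3 * l
  E≤ = +-monoˡ-≤ (3 * l) (+-monoʳ-≤ 2 g₂≤g₁)
  L  = 2 ^ (4 + 2 * g₁ + l)
  D₁ = 2 ^ (3 + g₁ + 8 * l)
  D₂ = 2 ^ (3 + g₂ + 8 * l)
  Z  = 2 ^ (2 * l)
  instance
    L≢0 : NonZero L
    L≢0 = 2^≢0 (4 + 2 * g₁ + l)
  open ≤-Reasoning
  D+D≡2*D : ∀ D → D + D ≡ 2 * D
  D+D≡2*D D = cong (D +_) (sym (+-identityʳ D))

  conclude : ∃[ j ] length B ≤ 2 ^ V * length (block B L j) → length B ≤ 2 ^ (V + (4 + g₂ + 12 * l))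
  conclude (j , B≤) = first (concentration l g₁ B₀ 7≤l (≤-trans 1≤g₂ g₂≤g₁) 8E≤
    (Sieved-⊆ (λ a∈ → proj₁ (∈-filter⁻ (λ a → a / L ≟ j) {xs = B} a∈)) ≤-refl sieved) (block-diameter {B} L j))
    where
    B₀ = block B L j
    first : ∃[ a ] length B₀ ≤ Z * length (near B₀ D₁ a) → length B ≤ 2 ^ (V + (4 + g₂ + 12 * l))
    first (a , B₀≤) = second (concentration l g₂ B₁ 7≤l 1≤g₂ (≤-trans (*-monoʳ-≤ 8 E≤) 8E≤)
      (Sieved-⊆ (λ b∈ → proj₁ (∈-filter⁻ (λ a → a / L ≟ j) {xs = B} (proj₁ (∈-filter⁻ (λ a' → ∣ a - a' ∣ <? D₁) {xs = B₀} b∈)))) (^-monoʳ-≤ 2 E≤) sieved)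
      (λ b∈ b'∈ → ≤-trans (near-diameter {B₀} D₁ a b∈ b'∈) D₁+D₁≤))
      where
      B₁ = near B₀ D₁ a
      D₁+D₁≤ : D₁ + D₁ ≤ 2 ^ (4 + 2 * g₂ + l)
      D₁+D₁≤ = ≤-trans (≤-reflexive (D+D≡2*D D₁)) (^-monoʳ-≤ 2 (+-monoʳ-≤ 4 g₁≤))
      second : ∃[ a ] length B₁ ≤ Z * length (near B₁ D₂ a) → length B ≤ 2 ^ (V + (4 + g₂ + 12 * l))
      second (b , B₁≤) = begin
        length B                                   ≤⟨ B≤ ⟩
        2 ^ V * length B₀                          ≤⟨ *-monoʳ-≤ (2 ^ V) B₀≤ ⟩
        2 ^ V * (Z * length B₁)                    ≤⟨ *-monoʳ-≤ (2 ^ V) (*-monoʳ-≤ Z B₁≤) ⟩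
        2 ^ V * (Z * (Z * length (near B₁ D₂ b)))  ≤⟨ *-monoʳ-≤ (2 ^ V) (*-monoʳ-≤ Z (*-monoʳ-≤ Z (near-length {B₁} D₂ b
                                                        (Distinct-filter (λ a' → ∣ a - a' ∣ <? D₁) {B₀} (Distinct-filter (λ a → a / L ≟ j) {B} distinct))))) ⟩
        2 ^ V * (Z * (Z * (D₂ + D₂)))              ≡⟨ cong (λ x → 2 ^ V * (Z * (Z * x))) (D+D≡2*D D₂) ⟩
        2 ^ V * (Z * (Z * 2 ^ (4 + g₂ + 8 * l)))   ≡⟨ cong (λ x → 2 ^ V * (Z * x)) (2^-* (2 * l) (4 + g₂ + 8 * l) refl) ⟩
        2 ^ V * (Z * 2 ^ (2 * l + (4 + g₂ + 8 * l))) ≡⟨ cong (2 ^ V *_) (2^-* (2 * l) _ (exponents g₂ l)) ⟩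
        2 ^ V * 2 ^ (4 + g₂ + 12 * l)              ≡⟨ 2^-* V (4 + g₂ + 12 * l) refl ⟩
        2 ^ (V + (4 + g₂ + 12 * l))                ∎
        where exponents : ∀ g l → 2 * l + (2 * l + (4 + g + 8 * l)) ≡ 4 + g + 12 * l
              exponents = solve-∀

-- The sieve of the statement

∈-sievedSet : ∀ N s {a} → a ∈ sievedSet N s → T (survivesᵇ N s a) × 1 ≤ a × a ≤ N
∈-sievedSet N s {a} a∈ with a∈range , surv ← ∈-filter⁻ (T? ∘ survivesᵇ N s) {xs = map suc (upTo N)} a∈
  with i , i∈ , refl ← ∈-map⁻ suc a∈range = surv , s≤s z≤n , ∈-upTo⁻ i∈

sievedSet-distinct : ∀ N s → Distinct (sievedSet N s)
sievedSet-distinct N s = Distinct-filter (T? ∘ survivesᵇ N s) {map suc (upTo N)} λ u →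
  ≤-trans (≤-reflexive (∑-map suc (upTo N) (λ a → 𝟙 (a ≟ u))))
          (∑<-unique N (λ i → suc i ≟ u) λ p q → suc-injective (trans p (sym q)))

sievedCount≤N : ∀ N s → sievedCount N s ≤ N
sievedCount≤N N s = length-≤-interval 1 N (sievedSet-distinct N s) λ a∈ →
  let _ , 1≤a , a≤N = ∈-sievedSet N s a∈ in 1≤a , s≤s a≤N

T-not : ∀ {b} → T (not b) → ¬ T b
T-not {false} _ ()

-- For p < 2^E one has p² ≤ N, hence also p ≤ N, so p occurs in the search made by `survivesᵇ`. A
-- survivor in the interval of p would make that search succeed.
sievedSet-sieved : ∀ N s E → 2 ^ (E + E) ≤ N → Sieved (sievedSet N s) (2 ^ E)
sievedSet-sieved N s E P²≤N {p} (pp , p≢2) p<P = s p , miss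
  where
  p²≤N : p * p ≤ N
  p²≤N = ≤-trans (*-mono-≤ (<⇒≤ p<P) (<⇒≤ p<P)) (≤-trans (≤-reflexive (2^-* E E refl)) P²≤N)
  p≤N : p ≤ N
  p≤N = ≤-trans (m≤m*n p p {{prime⇒nonZero pp}}) p²≤N
  T-not⁺ : ∀ {b} → ¬ T b → T (not b)
  T-not⁺ {false} _ = _
  T-not⁺ {true}  h = h _
  _and_ : ∀ {x y} → T x → T y → T (x ∧ y)
  _and_ {x} {y} tx ty = Equivalence.from (T-∧ {x} {y}) (tx , ty)
  miss : Misses (sievedSet N s) p (s p) ((p ∸ 1) / 2)
  miss {a} {k} a∈ k< eq = T-not (proj₁ (∈-sievedSet N s a∈))
    (any⁺ (λ p → oddPrimeᵇ p ∧ ((p * p ≤ᵇ N) ∧ inIntervalᵇ p (s p) a)) (lose (∈-upTo⁺ (s≤s p≤N))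
      (_and_ {oddPrimeᵇ p} (_and_ {isYes (prime? p)} (fromWitness pp) (T-not⁺ (p≢2 ∘ ≡ᵇ⇒≡ p 2)))
        (_and_ {p * p ≤ᵇ N} (≤⇒≤ᵇ p²≤N) in-interval))))
    where
    in-interval : T (inIntervalᵇ p (s p) a)
    in-interval = any⁺ (λ k → modℕ p (s p + k) ≡ᵇ modℕ p a) (lose (∈-upTo⁺ k<) (≡⇒≡ᵇ (modℕ p (s p + k)) (modℕ p a) eq))

-- Choice of parameters and the final bound

bracket : ∀ (f : ℕ → ℕ) N k → f 0 ≤ N → N < f k → ∃[ l ] (f l ≤ N × N < f (suc l))
bracket f N zero    f0≤N N<fk = contradiction f0≤N (<⇒≱ N<fk)
bracket f N (suc k) f0≤N N<fk with f k ≤? N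
... | yes fk≤N = k , fk≤N , N<fk
... | no  fk≰N = bracket f N k f0≤N (≰⇒> fk≰N)

-- The left side is 8 times the exponent of P in the first round, as `primes-dense` requires. The
-- smallest l that works is 15.
linear≤2^ : ∀ l → 15 ≤ l → 8 * (2 + 149 * l) ≤ 2 ^ l
linear≤2^ l 15≤l = subst (λ l → 8 * (2 + 149 * l) ≤ 2 ^ l) (m+[n∸m]≡n 15≤l) (from-15 (l ∸ 15))
  where
  open ≤-Reasoning
  double : ∀ k → 8 * (2 + 149 * (15 + suc k)) + (16704 + 1192 * k) ≡ 2 * (8 * (2 + 149 * (15 + k)))
  double = solve-∀
  from-15 : ∀ k → 8 * (2 + 149 * (15 + k)) ≤ 2 ^ (15 + k)
  from-15 zero    = ≤ᵇ⇒≤ _ _ _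
  from-15 (suc k) = begin
    8 * (2 + 149 * (15 + suc k))                       ≤⟨ m≤m+n _ (16704 + 1192 * k) ⟩
    8 * (2 + 149 * (15 + suc k)) + (16704 + 1192 * k)  ≡⟨ double k ⟩
    2 * (8 * (2 + 149 * (15 + k)))                     ≤⟨ *-monoʳ-≤ 2 (from-15 k) ⟩
    2 ^ (15 + suc k)                                   ∎

-- Take g₁ = 146 l, so that P² = 2^(4 + 298 l) ≤ N, and g₂ = 77 l, as 77 is the least integer with
-- 146 + 8 ≤ 2 · 77 + 1. V = 7 l + 296 lets the blocks cover everything below 2^(300 l + 300). The
-- exponent is then 96 l, less than a third of 300 l, up to a constant.
sievedCount-≤ : ∀ N s l → 15 ≤ l → 2 ^ (300 * l) ≤ N → N < 2 ^ (300 * l + 300) →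
  sievedCount N s ≤ 2 ^ (96 * l + 300)
sievedCount-≤ N s l 15≤l ≤N N< = subst (λ e → sievedCount N s ≤ 2 ^ e) (total l)
  (two-steps l (146 * l) (77 * l) (7 * l + 296) (sievedSet N s)
    (≤-trans (m≤m+n 7 8) 15≤l) (≤-trans (≤-trans (m≤m+n 1 14) 15≤l) (m≤n*m l 77)) (*-monoˡ-≤ l (m≤m+n 77 69)) (≤-trans (m≤m+n _ l) (≤-reflexive (fits l)))
    (subst (λ e → 8 * e ≤ 2 ^ l) (sym (level l)) (linear≤2^ l 15≤l))
    (sievedSet-sieved N s (2 + 146 * l + 3 * l) (≤-trans (^-monoʳ-≤ 2 square≤) ≤N))
    (sievedSet-distinct N s)
    λ a∈ → ≤-<-trans (proj₂ (proj₂ (∈-sievedSet N s a∈))) (subst (λ e → N < 2 ^ e) (size l) N<))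
  where
  total : ∀ l → 7 * l + 296 + (4 + 77 * l + 12 * l) ≡ 96 * l + 300
  total = solve-∀
  fits : ∀ l → 146 * l + 8 * l + l ≡ 2 * (77 * l) + l
  fits = solve-∀
  level : ∀ l → 2 + 146 * l + 3 * l ≡ 2 + 149 * l
  level = solve-∀
  double : ∀ l → (2 + 146 * l + 3 * l) + (2 + 146 * l + 3 * l) ≡ 4 + 298 * l
  double = solve-∀
  square : ∀ l → 2 * l + 298 * l ≡ 300 * l
  square = solve-∀
  square≤ : (2 + 146 * l + 3 * l) + (2 + 146 * l + 3 * l) ≤ 300 * l
  square≤ = ≤-trans (≤-reflexive (double l)) (≤-trans (+-monoˡ-≤ (298 * l) (*-monoʳ-≤ 2 (≤-trans (m≤m+n 2 13) 15≤l))) (≤-reflexive (square l)))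
  size : ∀ l → 300 * l + 300 ≡ 7 * l + 296 + (4 + 2 * (146 * l) + l)
  size = solve-∀

-- For l ≥ 15 the cube has exponent 288 l + 900 ≤ 300 l + 3 c. For l < 15 the trivial bound
-- suffices: |A| ≤ N < 2^(300 · 15) = 2^4500 ≤ 2^c.
sievedCount³≤ : ∀ c → 4500 ≤ c → ∀ N → N ≥ 1 → ∀ s → sievedCount N s ^ 3 ≤ (2 ^ c) ^ 3 * N
sievedCount³≤ c 4500≤c N N≥1 s = split (bracket (λ l → 2 ^ (300 * l)) N N N≥1 (<-≤-trans (n<m^n 2 N) (^-monoʳ-≤ 2 (m≤n*m N 300))))
  where
  open ≤-Reasoning
  exponents : ∀ l → (96 * l + 300) * 3 ≡ 288 * l + 900
  exponents = solve-∀
  next : ∀ l → 300 * suc l ≡ 300 * l + 300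
  next = solve-∀
  exponent≤ : ∀ l → (96 * l + 300) * 3 ≤ c * 3 + 300 * l
  exponent≤ l = begin
    (96 * l + 300) * 3    ≡⟨ exponents l ⟩
    288 * l + 900         ≤⟨ +-mono-≤ (*-monoˡ-≤ l (≤ᵇ⇒≤ 288 300 _)) (≤-trans (≤ᵇ⇒≤ 900 4500 _) (≤-trans 4500≤c (m≤m*n c 3))) ⟩
    300 * l + c * 3       ≡⟨ +-comm (300 * l) (c * 3) ⟩
    c * 3 + 300 * l       ∎
  split : ∃[ l ] (2 ^ (300 * l) ≤ N × N < 2 ^ (300 * suc l)) → sievedCount N s ^ 3 ≤ (2 ^ c) ^ 3 * N
  split (l , ≤N , N<) with 15 ≤? l
  ... | no 15≰l = begin
    sievedCount N s ^ 3            ≤⟨ ^-monoˡ-≤ 3 (≤-trans (sievedCount≤N N s) (<⇒≤ (<-≤-trans N< (^-monoʳ-≤ 2 (≤-trans (*-monoʳ-≤ 300 (≰⇒> 15≰l)) 4500≤c))))) ⟩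
    (2 ^ c) ^ 3                    ≤⟨ m≤m*n ((2 ^ c) ^ 3) N {{>-nonZero N≥1}} ⟩
    (2 ^ c) ^ 3 * N                ∎
  ... | yes 15≤l = begin
    sievedCount N s ^ 3                    ≤⟨ ^-monoˡ-≤ 3 (sievedCount-≤ N s l 15≤l ≤N (subst (λ e → N < 2 ^ e) (next l) N<)) ⟩
    (2 ^ (96 * l + 300)) ^ 3               ≡⟨ ^-*-assoc 2 (96 * l + 300) 3 ⟩
    2 ^ ((96 * l + 300) * 3)               ≤⟨ ^-monoʳ-≤ 2 (exponent≤ l) ⟩
    2 ^ (c * 3 + 300 * l)                  ≡⟨ ^-distribˡ-+-* 2 (c * 3) (300 * l) ⟩
    2 ^ (c * 3) * 2 ^ (300 * l)            ≤⟨ *-mono-≤ (≤-reflexive (sym (^-*-assoc 2 c 3))) ≤N ⟩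
    (2 ^ c) ^ 3 * N                        ∎

*-^ : ∀ m n o → (m * n) ^ o ≡ m ^ o * n ^ o
*-^ m n zero    = refl
*-^ m n (suc o) = trans (cong (m * n *_) (*-^ m n o)) (interchange m n (m ^ o) (n ^ o))
  where
  interchange : ∀ a b c d → a * b * (c * d) ≡ a * c * (b * d)
  interchange = solve-∀

-- With ε = a / b this is |A| ≤ 2^c N^(1/3 + ε) raised to the power 3 b. The previous bound is the
-- case ε = 0, and N ≥ 1 allows the larger exponent.
power-bound : ∀ c → 4500 ≤ c → ∀ a b N → N ≥ 1 → ∀ s →
  sievedCount N s ^ (3 * b) ≤ (2 ^ c) ^ (3 * b) * N ^ (b + 3 * a)
power-bound c 4500≤c a b N N≥1 s = begin
  sievedCount N s ^ (3 * b)             ≡⟨ ^-*-assoc (sievedCount N s) 3 b ⟨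
  (sievedCount N s ^ 3) ^ b             ≤⟨ ^-monoˡ-≤ b (sievedCount³≤ c 4500≤c N N≥1 s) ⟩
  ((2 ^ c) ^ 3 * N) ^ b                 ≡⟨ *-^ ((2 ^ c) ^ 3) N b ⟩
  ((2 ^ c) ^ 3) ^ b * N ^ b             ≡⟨ cong (_* N ^ b) (^-*-assoc (2 ^ c) 3 b) ⟩
  (2 ^ c) ^ (3 * b) * N ^ b             ≤⟨ *-monoʳ-≤ ((2 ^ c) ^ (3 * b)) (^-monoʳ-≤ N {{>-nonZero N≥1}} (m≤m+n b (3 * a))) ⟩
  (2 ^ c) ^ (3 * b) * N ^ (b + 3 * a)   ∎
  where open ≤-Reasoning

theorem1p5 : (a b : ℕ) → a ≥ 1 → b ≥ 1 →
    ∃[ C ] ((N : ℕ) → N ≥ 1 → (s : ℕ → ℕ) →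
    sievedCount N s ^ (3 * b) ≤ C ^ (3 * b) * N ^ (b + 3 * a))
theorem1p5 a b _ _ = 2 ^ 4500 , power-bound 4500 ≤-refl a b
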